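{- Let $B$ be either $\mathbb{N}\times\mathbb{N}$ or $\mathbb{Z}\times\mathbb{Z}$, and let $Q$ be the Queen graph on $B$. Then $\alpha_{\mathrm{od}}(Q)=1$.
   Context: Here $\mathbb{N}=\{1,2,3,\ldots\}$. The Queen graph on a board $B\subseteq\mathbb{Z}\times\mathbb{Z}$ has vertex set $B$, and two distinct vertices $(a,b),(a',b')$ are adjacent iff $a=a'$, or $b=b'$, or $a-a'=b-b'$, or $a-a'=b'-b$. For a graph $G=(V,E)$, $N(v)$ denotes the open neighborhood of $v$. A set $S\subseteq V$ (finite or infinite) is an odd independent set if it is independent and, for every vertex $v\in V\setminus S$, the set $N(v)\cap S$ is empty or of odd size. The odd independence number $\alpha_{\mathrm{od}}(G)$ is the largest size of an odd independent set of $G$; thus $\alpha_{\mathrm{od}}(G)=1$ means that $G$ has an odd independent set with exactly one element and that every odd independent set of $G$, finite or infinite, has at most one element. -}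

module Defs where

open import Algebra.Properties.AbelianGroup using (⁻¹-anti-homo‿-)
open import Data.Integer as ℤ using (ℤ; 1ℤ; _-_)
open import Data.Integer.Properties using (+-0-abelianGroup)
open import Data.List.Base using (List; length)
open import Data.List.Membership.Propositional using () renaming (_∈_ to _∈ₗ_)
open import Data.List.Relation.Unary.All using (All)
open import Data.List.Relation.Unary.Unique.Propositional using (Unique)
open import Data.Nat as ℕ using (ℕ)
open import Data.Nat.DivMod using (_%_)
open import Data.Product using (_×_; _,_; ∃-syntax; proj₁; proj₂)
open import Data.Refinement using (Refinement; value)
open import Data.Sum using (_⊎_; inj₁; inj₂)
open import Function using (_⇔_; _∘_)
open import Level using (0ℓ)
open import Relation.Binary.Core using (Rel)
open import Relation.Binary.Definitions using (Symmetric)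
open import Relation.Binary.PropositionalEquality using (_≡_; _≢_; refl; sym; trans; cong; ≢-sym)
open import Relation.Nullary using (¬_)
open import Relation.Unary using (Pred; _∈_; _∉_; _∩_; Empty; U)

record Graph : Set₁ where
  field
    Vertex      : Set
    Adj         : Rel Vertex 0ℓ
    symmetric   : Symmetric Adj
    irreflexive : ∀ v → ¬ Adj v v

-- The list condition makes this a statement about finite sets only: an
-- infinite S has size n for no n.
HasSize : {A : Set} → Pred A 0ℓ → ℕ → Set
HasSize S n =
  ∃[ xs ] Unique xs × length xs ≡ n × (∀ v → v ∈ S ⇔ v ∈ₗ xs)

-- S is not assumed finite, so its size is bounded through its finite subsets.
HasSizeAtMost : {A : Set} → Pred A 0ℓ → ℕ → Set
HasSizeAtMost S n = ∀ xs → Unique xs → All S xs → length xs ℕ.≤ n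

HasOddSize : {A : Set} → Pred A 0ℓ → Set
HasOddSize S = ∃[ n ] HasSize S n × n % 2 ≡ 1

module _ (G : Graph) where
  open Graph G

  N : Vertex → Pred Vertex 0ℓ
  N v w = Adj v w

  Independent : Pred Vertex 0ℓ → Set
  Independent S = ∀ v w → v ∈ S → w ∈ S → ¬ Adj v w

  OddIndependent : Pred Vertex 0ℓ → Set
  OddIndependent S =
    Independent S ×
    (∀ v → v ∉ S → Empty (N v ∩ S) ⊎ HasOddSize (N v ∩ S))

  -- αod(G) = n, as a relation: the maximum need not exist for infinite G.
  OddIndependenceNumber : ℕ → Set₁
  OddIndependenceNumber n =
    (∃[ S ] OddIndependent S × HasSize S n) ×
    (∀ S → OddIndependent S → HasSizeAtMost S n)

Board : Set₁
Board = Pred (ℤ × ℤ) 0ℓ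

-- Membership in B is irrelevant in a refinement, so vertices are equal as
-- soon as their coordinates are.
Square : Board → Set
Square B = Refinement (ℤ × ℤ) B

module _ {B : Board} where

  col row : Square B → ℤ
  col = proj₁ ∘ value
  row = proj₂ ∘ value

  QueenAdj : Rel (Square B) 0ℓ
  QueenAdj v w =
    v ≢ w ×
    ( col v ≡ col w
    ⊎ row v ≡ row w
    ⊎ col v - col w ≡ row v - row w
    ⊎ col v - col w ≡ row w - row v )

  private
    flip- : ∀ a b c d → a - b ≡ c - d → b - a ≡ d - c
    flip- a b c d eq =
      trans (sym (anti a b)) (trans (cong ℤ.-_ eq) (anti c d))
      where anti = ⁻¹-anti-homo‿- +-0-abelianGroup

  QueenAdj-sym : Symmetric QueenAdj
  QueenAdj-sym (v≢w , inj₁ eq) = ≢-sym v≢w , inj₁ (sym eq)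
  QueenAdj-sym (v≢w , inj₂ (inj₁ eq)) = ≢-sym v≢w , inj₂ (inj₁ (sym eq))
  QueenAdj-sym {v} {w} (v≢w , inj₂ (inj₂ (inj₁ eq))) =
    ≢-sym v≢w ,
    inj₂ (inj₂ (inj₁ (flip- (col v) (col w) (row v) (row w) eq)))
  QueenAdj-sym {v} {w} (v≢w , inj₂ (inj₂ (inj₂ eq))) =
    ≢-sym v≢w ,
    inj₂ (inj₂ (inj₂ (flip- (col v) (col w) (row w) (row v) eq)))

Queen : Board → Graph
Queen B = record
  { Vertex      = Square B
  ; Adj         = QueenAdj
  ; symmetric   = QueenAdj-sym
  ; irreflexive = λ _ adj → proj₁ adj refl
  }

-- Here ℕ starts at 1, as a subset of ℤ.
ℕ×ℕ : Board
ℕ×ℕ (a , b) = 1ℤ ℤ.≤ a × 1ℤ ℤ.≤ b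

ℤ×ℤ : Board
ℤ×ℤ = U

{-# OPTIONS --safe #-}

-- Write c, r, d, a for the sets of occupied columns, rows, diagonals (x - y)
-- and antidiagonals (x + y).  A line holds at most one queen, so a square
-- without a queen lies on 0, 1 or 3 occupied lines, and on an odd number if a
-- queen attacks it.
--
-- Plane.  Around a queen at the origin, addition modulo 2 gives
-- a(2t) = d(t) + d(-t) and d(2t) = a(t) + a(-t) for t ≠ 0, so a(2t) = a(-2t) and
-- a(4t) = 0.  If two queens had antidiagonals differing by 2t, there would be
-- a third one at distance 2t on the other side, and its antidiagonal differs
-- by 4t from that of the second: impossible.  Hence antidiagonals of distinct
-- queens differ by odd numbers and there are at most two queens; but a square
-- in the column of one and the row of the other requires a third queen.
--
-- Quadrant.  Put the origin at the queen on the lowest antidiagonal, and let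
-- (x , y) be the queen on the next one, x + y = s, so that a(t) = 0 for all
-- t < s except t = 0.  Up to reflection y < x.  Squares below
-- the next antidiagonal then propagate occupied diagonals as in Euclid's algorithm,
-- which leads to a contradiction unless the configuration is a dilation of
-- one of five small ones; these are refuted by inspecting finitely many squares.

module Submission where

import Algebra.Properties.AbelianGroup as AbelianGroup
open import Data.Bool.Base using (Bool; true; false; not; _∧_; _∨_; _xor_; if_then_else_)
open import Data.Bool.Properties
  using (∧-conicalˡ; ∧-conicalʳ; not-injective; not-involutive; xor-same; xor-comm)
open import Data.Empty using (⊥; ⊥-elim)
open import Data.Integer.Base using
  (ℤ; +_; -[1+_]; 0ℤ; 1ℤ; -1ℤ; -_; _+_; _-_; _*_; _≤_; _<_; +≤+; +<+; Positive; positive)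
open import Data.Integer.Properties
open import Data.Integer.Tactic.RingSolver using (solve-∀)
open import Data.Irrelevant using ([_])
open import Data.List.Base using (List; []; _∷_; map; _++_; concatMap; length)
open import Data.List.Membership.Propositional using (find; lose) renaming (_∈_ to _∈ₗ_)
open import Data.List.Relation.Unary.All as All using (All; []; _∷_)
import Data.List.Relation.Unary.All.Properties as All
open import Data.List.Relation.Unary.AllPairs using ([]; _∷_)
open import Data.List.Relation.Unary.Any using (Any; any?; here; there)
open import Data.List.Relation.Unary.Unique.Propositional using (Unique)
import Data.Nat.Base as ℕ
open import Data.Nat.Base using (ℕ)
open import Data.Nat.DivMod using (_%_)
import Data.Nat.Properties as ℕ
open import Data.Product using (_×_; _,_; ∃-syntax; ∃₂; proj₁; proj₂)
open import Data.Product.Properties using (,-injectiveˡ; ,-injectiveʳ) renaming (≡-dec to ×-≡-dec)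
open import Data.Refinement using (value; _,_)
open import Data.Refinement.Properties using (value-injective) renaming (_≟_ to ≟-refinement)
open import Data.Sum as Sum using (_⊎_; inj₁; inj₂)
open import Data.Unit using (⊤; tt)
open import Defs
open import Function using (_∘_; _⇔_; Equivalence; mk⇔)
open import Level using (0ℓ)
open import Relation.Binary.Definitions using (tri<; tri≈; tri>)
open import Relation.Binary.PropositionalEquality
open import Relation.Nullary using (¬_; Dec; yes; no; does; contradiction; _×-dec_; _⊎-dec_; ¬?)
open import Relation.Nullary.Decidable using (map′; dec-false; dec-true; recompute; does-⇔)
open import Relation.Unary using (Pred; _∈_; _∉_; _∩_; Empty; ｛_｝)

open AbelianGroup +-0-abelianGroup using ()
  renaming (∙-cancelˡ to +-cancelˡ; ∙-cancelʳ to +-cancelʳ)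

-- Configurations of occupied lines

Cell : Set
Cell = ℤ × ℤ

-- c and r are indexed by a coordinate, d by x - y and a by x + y.
data Line : Set where
  c r d a : ℤ → Line

infix 4 _≟ₗ_

_≟ₗ_ : (l m : Line) → Dec (l ≡ m)
c i ≟ₗ c j = map′ (cong c) (λ { refl → refl }) (i ≟ j)
r i ≟ₗ r j = map′ (cong r) (λ { refl → refl }) (i ≟ j)
d i ≟ₗ d j = map′ (cong d) (λ { refl → refl }) (i ≟ j)
a i ≟ₗ a j = map′ (cong a) (λ { refl → refl }) (i ≟ j)
c _ ≟ₗ r _ = no λ ()
c _ ≟ₗ d _ = no λ ()
c _ ≟ₗ a _ = no λ ()
r _ ≟ₗ c _ = no λ ()
r _ ≟ₗ d _ = no λ ()
r _ ≟ₗ a _ = no λ ()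
d _ ≟ₗ c _ = no λ ()
d _ ≟ₗ r _ = no λ ()
d _ ≟ₗ a _ = no λ ()
a _ ≟ₗ c _ = no λ ()
a _ ≟ₗ r _ = no λ ()
a _ ≟ₗ d _ = no λ ()

Rule : Set
Rule = Bool → Bool → Bool → Bool → Bool

odd : Rule
odd p q u v = p xor (q xor (u xor v))

-- Not exactly two: all four lines of a square are occupied when its queen is.
allowed : Rule
allowed p q u v = odd p q u v ∨ not ((p xor q) ∨ (q xor u) ∨ (u xor v))

obeys : Rule → (Line → Bool) → ℤ → ℤ → Set
obeys f on x y = f (on (c x)) (on (r y)) (on (d (x - y))) (on (a (x + y))) ≡ true

Share : ℤ → ℤ → ℤ → ℤ → Set
Share x y x′ y′ = x ≡ x′ ⊎ y ≡ y′ ⊎ x - y ≡ x′ - y′ ⊎ x + y ≡ x′ + y′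

-- The board is X × Y.  HasQueen need only hold at some of the queens, so that a
-- model can be restricted to the squares of a sublattice.
record Model : Set₁ where
  field
    X Y      : ℤ → Set
    HasQueen : ℤ → ℤ → Set
    on       : Line → Bool
    weak     : ∀ x y → X x → Y y → obeys allowed on x y
    strong   : ∀ {x′ y′} → HasQueen x′ y′ → ∀ x y → X x → Y y →
               (x , y) ≢ (x′ , y′) → Share x y x′ y′ → obeys odd on x y
    onc      : ∀ {x y} → HasQueen x y → on (c x) ≡ true
    onr      : ∀ {x y} → HasQueen x y → on (r y) ≡ true
    ond      : ∀ {x y} → HasQueen x y → on (d (x - y)) ≡ true
    ona      : ∀ {x y} → HasQueen x y → on (a (x + y)) ≡ true
    inX      : ∀ {x y} → HasQueen x y → X x
    inY      : ∀ {x y} → HasQueen x y → Y y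

obeys-cong : ∀ f (on on′ : Line → Bool) (x y x′ y′ : ℤ) →
  on (c x) ≡ on′ (c x′) → on (r y) ≡ on′ (r y′) →
  on (d (x - y)) ≡ on′ (d (x′ - y′)) → on (a (x + y)) ≡ on′ (a (x′ + y′)) →
  obeys f on x y → obeys f on′ x′ y′
obeys-cong f on on′ x y x′ y′ p q u v h =
  trans (sym (trans (cong₂ (λ i j → f i j _ _) p q) (cong₂ (f _ _) u v))) h

diff-translate : ∀ p q x y → p + x - (q + y) ≡ p - q + (x - y)
diff-translate = solve-∀

plus-translate : ∀ p q x y → p + x + (q + y) ≡ p + q + (x + y)
plus-translate = solve-∀

module _ (M : Model) where
  open Model M

  translate : ℤ → ℤ → Model
  translate p q = record
    { X = λ x → X (p + x) ; Y = λ y → Y (q + y)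
    ; HasQueen = λ x y → HasQueen (p + x) (q + y)
    ; on = on ∘ shift
    ; weak = λ x y x∈ y∈ → move allowed x y (weak (p + x) (q + y) x∈ y∈)
    ; strong = λ {x′} {y′} Q x y x∈ y∈ z≢w sh → move odd x y
        (strong Q (p + x) (q + y) x∈ y∈
          (λ eq → z≢w (cong₂ _,_ (+-cancelˡ p x x′ (cong proj₁ eq)) (+-cancelˡ q y y′ (cong proj₂ eq))))
          (share x y x′ y′ sh))
    ; onc = onc ; onr = onr
    ; ond = λ {x} {y} Q → trans (cong (on ∘ d) (sym (diff x y))) (ond Q)
    ; ona = λ {x} {y} Q → trans (cong (on ∘ a) (sym (plus x y))) (ona Q)
    ; inX = inX ; inY = inY
    }
    where
    shift : Line → Line
    shift (c t) = c (p + t)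
    shift (r t) = r (q + t)
    shift (d t) = d (p - q + t)
    shift (a t) = a (p + q + t)

    diff : ∀ x y → p + x - (q + y) ≡ p - q + (x - y)
    diff = diff-translate p q

    plus : ∀ x y → p + x + (q + y) ≡ p + q + (x + y)
    plus = plus-translate p q

    move : ∀ f x y → obeys f on (p + x) (q + y) → obeys f (on ∘ shift) x y
    move f x y = obeys-cong f on (on ∘ shift) (p + x) (q + y) x y refl refl
      (cong (on ∘ d) (diff x y)) (cong (on ∘ a) (plus x y))

    share : ∀ x y x′ y′ → Share x y x′ y′ → Share (p + x) (q + y) (p + x′) (q + y′)
    share x y x′ y′ = Sum.map (cong (λ t → p + t)) (Sum.map (cong (λ t → q + t)) (Sum.map
      (λ eq → trans (diff x y) (trans (cong (λ t → p - q + t) eq) (sym (diff x′ y′))))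
      (λ eq → trans (plus x y) (trans (cong (λ t → p + q + t) eq) (sym (plus x′ y′))))))

  -- Sums and differences of multiples of `g` are multiples of `g`, so the squares of the sublattice
  -- lie only on lines with such indices. Occupancy still counts the queens off the sublattice,
  -- hence both rules survive.
  scale : (g : ℤ) .{{_ : Positive g}} → Model
  scale g@(+ ℕ.suc _) = record
    { X = λ x → X (x * g) ; Y = λ y → Y (y * g)
    ; HasQueen = λ x y → HasQueen (x * g) (y * g)
    ; on = on ∘ stretch
    ; weak = λ x y x∈ y∈ → move allowed x y (weak (x * g) (y * g) x∈ y∈)
    ; strong = λ {x′} {y′} Q x y x∈ y∈ z≢w sh → move odd x y
        (strong Q (x * g) (y * g) x∈ y∈
          (λ eq → z≢w (cong₂ _,_ (*-cancelʳ-≡ x x′ g (cong proj₁ eq)) (*-cancelʳ-≡ y y′ g (cong proj₂ eq))))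
          (share x y x′ y′ sh))
    ; onc = onc ; onr = onr
    ; ond = λ {x} {y} Q → trans (cong (on ∘ d) (sym (diff g x y))) (ond Q)
    ; ona = λ {x} {y} Q → trans (cong (on ∘ a) (sym (plus g x y))) (ona Q)
    ; inX = inX ; inY = inY
    }
    where
    stretch : Line → Line
    stretch (c t) = c (t * g)
    stretch (r t) = r (t * g)
    stretch (d t) = d (t * g)
    stretch (a t) = a (t * g)

    diff : ∀ g x y → x * g - y * g ≡ (x - y) * g
    diff = solve-∀

    plus : ∀ g x y → x * g + y * g ≡ (x + y) * g
    plus = solve-∀

    move : ∀ f x y → obeys f on (x * g) (y * g) → obeys f (on ∘ stretch) x y
    move f x y = obeys-cong f on (on ∘ stretch) (x * g) (y * g) x y refl refl
      (cong (on ∘ d) (diff g x y)) (cong (on ∘ a) (plus g x y))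

    share : ∀ x y x′ y′ → Share x y x′ y′ → Share (x * g) (y * g) (x′ * g) (y′ * g)
    share x y x′ y′ = Sum.map (cong (_* g)) (Sum.map (cong (_* g)) (Sum.map
      (λ eq → trans (diff g x y) (trans (cong (_* g) eq) (sym (diff g x′ y′))))
      (λ eq → trans (plus g x y) (trans (cong (_* g) eq) (sym (plus g x′ y′))))))

  -- Reflection in the main diagonal fixes every antidiagonal, so the hypotheses of `Corner` on `a`
  -- carry over unchanged.
  mirror : Model
  mirror = record
    { X = Y ; Y = X
    ; HasQueen = λ x y → HasQueen y x
    ; on = on ∘ flip
    ; weak = λ x y x∈ y∈ → move allowed allowed-swap x y (weak y x y∈ x∈)
    ; strong = λ {x′} {y′} Q x y x∈ y∈ z≢w sh → move odd odd-swap x y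
        (strong Q y x y∈ x∈ (λ { refl → z≢w refl }) (share x y x′ y′ sh))
    ; onc = onr ; onr = onc
    ; ond = λ {x} {y} Q → trans (cong (on ∘ d) (sym (diff x y))) (ond Q)
    ; ona = λ {x} {y} Q → trans (cong (on ∘ a) (+-comm x y)) (ona Q)
    ; inX = inY ; inY = inX
    }
    where
    flip : Line → Line
    flip (c t) = r t
    flip (r t) = c t
    flip (d t) = d (- t)
    flip (a t) = a t

    diff : ∀ x y → y - x ≡ - (x - y)
    diff = solve-∀

    odd-swap : ∀ p q u v → odd p q u v ≡ odd q p u v
    odd-swap true  true  _ _ = refl
    odd-swap true  false _ _ = refl
    odd-swap false true  _ _ = refl
    odd-swap false false _ _ = refl

    allowed-swap : ∀ p q u v → allowed p q u v ≡ allowed q p u v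
    allowed-swap true  true  _ _ = refl
    allowed-swap true  false _ _ = refl
    allowed-swap false true  _ _ = refl
    allowed-swap false false _ _ = refl

    move : ∀ f → (∀ p q u v → f p q u v ≡ f q p u v) → ∀ x y →
           obeys f on y x → obeys f (on ∘ flip) x y
    move f swap x y h =
      trans (swap (on (r x)) (on (c y)) _ _)
      (trans (cong₂ (f (on (c y)) (on (r x)))
               (cong (on ∘ d) (sym (diff x y))) (cong (on ∘ a) (+-comm x y))) h)

    share : ∀ x y x′ y′ → Share x y x′ y′ → Share y x y′ x′
    share x y x′ y′ (inj₁ eq) = inj₂ (inj₁ eq)
    share x y x′ y′ (inj₂ (inj₁ eq)) = inj₁ eq
    share x y x′ y′ (inj₂ (inj₂ (inj₁ eq))) =
      inj₂ (inj₂ (inj₁ (trans (diff x y) (trans (cong -_ eq) (sym (diff x′ y′))))))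
    share x y x′ y′ (inj₂ (inj₂ (inj₂ eq))) =
      inj₂ (inj₂ (inj₂ (trans (+-comm y x) (trans eq (+-comm x′ y′)))))

-- Finite refutations

Values : Set
Values = List (Line × Bool)

-- `otherwise` is the result for a line without a recorded value; `decide` puts the case split
-- there.
look-up : Line → Values → (Bool → Bool) → Bool → Bool
look-up l [] k otherwise = otherwise
look-up l ((m , b) ∷ Γ) k otherwise = if does (l ≟ₗ m) then k b else look-up l Γ k otherwise

decide : Line → Values → (Bool → Values → Bool) → Bool
decide l Γ k = look-up l Γ (λ b → k b Γ) (k true ((l , true) ∷ Γ) ∧ k false ((l , false) ∷ Γ))

share? : ∀ x y x′ y′ → Dec (Share x y x′ y′)
share? x y x′ y′ = x ≟ x′ ⊎-dec y ≟ y′ ⊎-dec x - y ≟ x′ - y′ ⊎-dec x + y ≟ x′ + y′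

Attacks : Cell → Cell → Set
Attacks (x , y) (x′ , y′) = (x , y) ≢ (x′ , y′) × Share x y x′ y′

attacks? : ∀ z w → Dec (Attacks z w)
attacks? (x , y) (x′ , y′) = ¬? (×-≡-dec _≟_ _≟_ (x , y) (x′ , y′)) ×-dec share? x y x′ y′

queenLines : Cell → Values
queenLines (x , y) = (c x , true) ∷ (r y , true) ∷ (d (x - y) , true) ∷ (a (x + y) , true) ∷ []

witness : ∀ {P : Set} (P? : Dec P) → does P? ≡ true → P
witness (yes p) _ = p

-- refutes zs Γ visits the squares zs in turn and splits on each line through
-- the square that Γ does not determine; a branch is closed by a square whose
-- rule is violated.
module Refutation (qs : List Cell) (m : ℤ) where

  InRegion : Cell → Set
  InRegion (x , y) = 0ℤ ≤ x × m ≤ y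

  inRegion? : ∀ z → Dec (InRegion z)
  inRegion? (x , y) = 0ℤ ≤? x ×-dec m ≤? y

  rule : Cell → Rule
  rule z = if does (any? (attacks? z) qs) then odd else allowed

  refutes : List Cell → Values → Bool
  refutesᶜ : Cell → List Cell → Bool → Values → Bool
  refutesʳ : Cell → List Cell → Bool → Bool → Values → Bool
  refutesᵈ : Cell → List Cell → Bool → Bool → Bool → Values → Bool
  refutesᵃ : Cell → List Cell → Bool → Bool → Bool → Bool → Values → Bool

  -- Running out of squares leaves the branch open, so the check fails, as it does at a square
  -- outside the region.
  refutes [] Γ = false
  refutes (z@(x , y) ∷ zs) Γ = does (inRegion? z) ∧ decide (c x) Γ (refutesᶜ z zs)
  refutesᶜ z@(x , y) zs p Γ = decide (r y) Γ (refutesʳ z zs p)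
  refutesʳ z@(x , y) zs p q Γ = decide (d (x - y)) Γ (refutesᵈ z zs p q)
  refutesᵈ z@(x , y) zs p q u Γ = decide (a (x + y)) Γ (refutesᵃ z zs p q u)
  refutesᵃ z zs p q u v Γ = not (rule z p q u v) ∨ refutes zs Γ

  module _ (M : Model)
    (X⁺ : ∀ {x} → 0ℤ ≤ x → Model.X M x) (Y⁺ : ∀ {y} → m ≤ y → Model.Y M y)
    (queens : All (λ (x , y) → Model.HasQueen M x y) qs) where

    open Model M

    Holds : Values → Set
    Holds = All (λ (l , b) → on l ≡ b)

    look-up-sound : ∀ l {Γ k e} → look-up l Γ k e ≡ true → Holds Γ → k (on l) ≡ true ⊎ e ≡ true
    look-up-sound l {[]} eq [] = inj₂ eq
    look-up-sound l {(m , b) ∷ Γ} eq (h ∷ hs) with l ≟ₗ m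
    ... | no  _    = look-up-sound l eq hs
    ... | yes refl rewrite h = inj₁ eq

    -- The actual value `on l` selects the branch. Either it is recorded already, or both branches
    -- are refuted and the one for `on l` is followed, with that value added to the table.
    decide-sound : ∀ l {Γ} k → decide l Γ k ≡ true → Holds Γ →
      (∀ {Δ} → k (on l) Δ ≡ true → Holds Δ → ⊥) → ⊥
    decide-sound l {Γ} k eq hs done with look-up-sound l eq hs
    ... | inj₁ eq = done eq hs
    ... | inj₂ eq with on l in val
    ... | true  = done (∧-conicalˡ _ _ eq) (val ∷ hs)
    ... | false = done (∧-conicalʳ (k true _) _ eq) (val ∷ hs)

    obeys-rule : ∀ {x y} → InRegion (x , y) → obeys (rule (x , y)) on x y
    obeys-rule {x} {y} (0≤x , m≤y) with any? (attacks? (x , y)) qs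
    ... | no _ = weak x y (X⁺ 0≤x) (Y⁺ m≤y)
    ... | yes hit = attacked queens hit
      where
      attacked : ∀ {qs} → All (λ (x , y) → HasQueen x y) qs → Any (Attacks (x , y)) qs → obeys odd on x y
      attacked (Q ∷ _) (here (z≢w , sh)) = strong Q x y (X⁺ 0≤x) (Y⁺ m≤y) z≢w sh
      attacked (_ ∷ Qs) (there h) = attacked Qs h

    refutes-sound : ∀ zs {Γ} → refutes zs Γ ≡ true → Holds Γ → ⊥
    refutes-sound (z@(x , y) ∷ zs) {Γ} eq hs =
      decide-sound (c x) (refutesᶜ z zs) (∧-conicalʳ (does (inRegion? z)) _ eq) hs λ eq hs →
      decide-sound (r y) (refutesʳ z zs _) eq hs λ eq hs →
      decide-sound (d (x - y)) (refutesᵈ z zs _ _) eq hs λ eq hs →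
      decide-sound (a (x + y)) (refutesᵃ z zs _ _ _) eq hs λ eq hs →
      -- The rule holds at the actual values, so this square does not close the branch and the
      -- remaining ones must.
      refutes-sound zs (subst (λ b → not b ∨ refutes zs _ ≡ true) (obeys-rule z∈) eq) hs
      where
      z∈ : InRegion z
      z∈ = witness (inRegion? z) (∧-conicalˡ _ (decide (c x) Γ (refutesᶜ z zs)) eq)

-- The quadrant

gap : ∀ {i j} t → 0ℤ < t → i + t ≡ j → i < j
gap {i} t 0<t refl = subst (_< i + t) (+-identityʳ i) (+-monoʳ-< i 0<t)

difference>0 : ∀ {i j} → i < j → 0ℤ < j - i
difference>0 {i} {j} i<j = subst (_< j - i) (+-inverseʳ i) (+-monoˡ-< (- i) i<j)

difference+ : ∀ i j → i + (j - i) ≡ j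
difference+ = solve-∀

i-0 : ∀ i → i - 0ℤ ≡ i
i-0 = solve-∀

0-i : ∀ i → 0ℤ - i ≡ - i
0-i = solve-∀

i--j : ∀ i j → i - - j ≡ i + j
i--j = solve-∀

0--i : ∀ i → 0ℤ - - i ≡ i
0--i = solve-∀

-- In the names of the lemmas on odd and allowed, 1 and 0 stand for true and false.

odd-p1u0 : ∀ {p u} → odd p true u false ≡ true → p ≡ u
odd-p1u0 {true}  {true}  _ = refl
odd-p1u0 {false} {false} _ = refl

odd-1qu0 : ∀ {q u} → odd true q u false ≡ true → q ≡ u
odd-1qu0 {true}  {true}  _ = refl
odd-1qu0 {false} {false} _ = refl

odd-pq10 : ∀ {p q} → odd p q true false ≡ true → p ≡ q
odd-pq10 {true}  {true}  _ = refl
odd-pq10 {false} {false} _ = refl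

odd-11u1 : ∀ {u} → odd true true u true ≡ true → u ≡ false
odd-11u1 {false} _ = refl

odd-1q11 : ∀ {q} → odd true q true true ≡ true → q ≡ false
odd-1q11 {false} _ = refl

odd-p1u1 : ∀ {p u} → odd p true u true ≡ true → p ≡ not u
odd-p1u1 {true}  {false} _ = refl
odd-p1u1 {false} {true}  _ = refl

odd-1qu1 : ∀ {q u} → odd true q u true ≡ true → q ≡ not u
odd-1qu1 {true}  {false} _ = refl
odd-1qu1 {false} {true}  _ = refl

odd-not : ∀ {q u} → odd (not q) q u true ≡ true → u ≡ true
odd-not {true}  {true} _ = refl
odd-not {false} {true} _ = refl

allowed-1qu0 : ∀ {q u} → allowed true q u false ≡ true → q ≡ u
allowed-1qu0 {true}  {true}  _ = refl
allowed-1qu0 {false} {false} _ = refl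

allowed-p110 : ∀ {p} → allowed p true true false ≡ true → p ≡ true
allowed-p110 {true} _ = refl

allowed-1q10 : ∀ {q} → allowed true q true false ≡ true → q ≡ true
allowed-1q10 {true} _ = refl

allowed-11u0 : ∀ {u} → allowed true true u false ≡ true → u ≡ true
allowed-11u0 {true} _ = refl

not-fixed : ∀ {b} → b ≢ not b
not-fixed {true} ()
not-fixed {false} ()

-- The lowest antidiagonal and the next one

module Corner (M : Model)
  (origin : Model.HasQueen M 0ℤ 0ℤ)
  (X↑ : ∀ {x x′} → Model.X M x → x ≤ x′ → Model.X M x′)
  (Y↑ : ∀ {y y′} → Model.Y M y → y ≤ y′ → Model.Y M y′)
  (s : ℤ) (0<s : 0ℤ < s) (on-s : Model.on M (a s) ≡ true)
  (off : ∀ t → t ≢ 0ℤ → t < s → Model.on M (a t) ≡ false) where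

  open Model M

  NonzeroBelow : ℤ → ℤ → Set
  NonzeroBelow m t = t ≢ 0ℤ × t < m

  nonzeroBelow? : ∀ m t → Dec (NonzeroBelow m t)
  nonzeroBelow? m t = ¬? (t ≟ 0ℤ) ×-dec t <? m

  -- A contradiction among the squares whose coordinates are multiples of g,
  -- given queens at g * qs, and off at g * ts.  The lists of squares in the five
  -- applications below were found by computer search.
  coarse : ∀ g {{_ : Positive g}} m → m * g ≡ s →
    ∀ qs → All (λ (x , y) → HasQueen (x * g) (y * g)) qs →
    ∀ n → Y (n * g) → ∀ ts → does (All.all? (nonzeroBelow? m) ts) ≡ true →
    ∀ zs → Refutation.refutes ((0ℤ , 0ℤ) ∷ qs) n zs
      (concatMap queenLines ((0ℤ , 0ℤ) ∷ qs) ++ (a m , true) ∷ map (λ t → a t , false) ts) ≡ true → ⊥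
  coarse g@(+ ℕ.suc _) m mg≡s qs Qs n Yn ts ts< zs eq =
    Refutation.refutes-sound ((0ℤ , 0ℤ) ∷ qs) n (scale M g)
      (λ 0≤x → X↑ (inX origin) (*-monoʳ-≤-nonNeg g 0≤x)) (λ n≤y → Y↑ Yn (*-monoʳ-≤-nonNeg g n≤y))
      (origin ∷ Qs) zs eq
      (All.++⁺ (queens (origin ∷ Qs))
        (trans (cong (on ∘ a) mg≡s) on-s ∷ All.map⁺ (All.map offs (witness (All.all? (nonzeroBelow? m) ts) ts<))))
    where
    module G = Model (scale M g)

    queens : ∀ {qs} → All (λ (x , y) → HasQueen (x * g) (y * g)) qs →
      All (λ (l , b) → G.on l ≡ b) (concatMap queenLines qs)
    queens [] = []
    queens {(x , y) ∷ qs} (Q ∷ Qs) =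
      G.onc {x} {y} Q ∷ G.onr {x} {y} Q ∷ G.ond {x} {y} Q ∷ G.ona {x} {y} Q ∷ queens Qs

    offs : ∀ {t} → NonzeroBelow m t → on (a (t * g)) ≡ false
    offs {t} (t≢0 , t<m) = off (t * g) (λ tg≡0 → t≢0 (*-cancelʳ-≡ t 0ℤ g tg≡0))
      (subst (t * g <_) mg≡s (*-monoʳ-<-pos g t<m))

  module _ (g : ℤ) {{_ : Positive g}} where

    -- The proportion x = 2y left over in `NorthEast`; the unit `g` is y.
    ne-double : + 3 * g ≡ s → HasQueen (+ 2 * g) (1ℤ * g) → Y (0ℤ * g) → ⊥
    ne-double 3g≡s Q Y0 = coarse g (+ 3) 3g≡s ((+ 2 , 1ℤ) ∷ []) (Q ∷ []) 0ℤ Y0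
      (1ℤ ∷ + 2 ∷ []) refl
      ((+ 0 , + 1) ∷ (+ 2 , + 0) ∷ (+ 0 , + 2) ∷ (+ 2 , + 2) ∷ (+ 1 , + 3) ∷ (+ 0 , + 3) ∷
       (+ 3 , + 1) ∷ (+ 2 , + 3) ∷ (+ 1 , + 4) ∷ (+ 2 , + 4) ∷ (+ 3 , + 3) ∷ []) refl

    -- For k < s, shifting along columns in `SouthEast` leaves only k = s/2 and k = s/3, treated
    -- here and in `se-third` with unit k.
    se-half : + 2 * g ≡ s → HasQueen (+ 3 * g) (-1ℤ * g) → ⊥
    se-half 2g≡s Q = coarse g (+ 2) 2g≡s ((+ 3 , -1ℤ) ∷ []) (Q ∷ []) -1ℤ (inY Q)
      (1ℤ ∷ []) refl
      ((+ 1 , + 0) ∷ (+ 1 , + 1) ∷ (+ 2 , -1ℤ) ∷ (+ 2 , + 1) ∷ (+ 3 , + 0) ∷ []) refl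

    se-third : + 3 * g ≡ s → HasQueen (+ 4 * g) (-1ℤ * g) → ⊥
    se-third 3g≡s Q = coarse g (+ 3) 3g≡s ((+ 4 , -1ℤ) ∷ []) (Q ∷ []) -1ℤ (inY Q)
      (1ℤ ∷ + 2 ∷ []) refl
      ((+ 1 , -1ℤ) ∷ (+ 1 , + 1) ∷ (+ 0 , + 1) ∷ (+ 1 , + 2) ∷ (+ 2 , -1ℤ) ∷ (+ 3 , + 0) ∷
       (+ 2 , + 2) ∷ (+ 3 , + 1) ∷ []) refl

    -- The borderline k = s: the column 2s - k used in `middle` would be s itself, beyond the reach
    -- of `Gap`.
    se-equal : 1ℤ * g ≡ s → HasQueen (+ 2 * g) (-1ℤ * g) → ⊥
    se-equal g≡s Q = coarse g 1ℤ g≡s ((+ 2 , -1ℤ) ∷ []) (Q ∷ []) -1ℤ (inY Q)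
      (-1ℤ ∷ []) refl
      ((+ 1 , + 0) ∷ (+ 1 , -1ℤ) ∷ (+ 2 , + 0) ∷ (+ 1 , + 1) ∷ (+ 0 , + 1) ∷ (+ 2 , + 1) ∷
       (+ 1 , + 2) ∷ (+ 0 , + 2) ∷ (+ 3 , + 0) ∷ (+ 1 , + 3) ∷ (+ 3 , -1ℤ) ∷ (+ 4 , + 0) ∷
       (+ 2 , + 3) ∷ (+ 4 , + 1) ∷ []) refl

    -- With the rows down to -2s on the board, the queen at the origin, the occupied antidiagonal s
    -- and the empty ones below 0 already clash. This serves every k ≥ 2s.
    deep : 1ℤ * g ≡ s → Y (-[1+ 1 ] * g) → ⊥
    deep g≡s Y-2 = coarse g 1ℤ g≡s [] [] -[1+ 1 ] Y-2
      (-1ℤ ∷ -[1+ 1 ] ∷ []) refl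
      ((+ 0 , -1ℤ) ∷ (+ 1 , + 0) ∷ (+ 1 , -1ℤ) ∷ (+ 0 , -[1+ 1 ]) ∷ (+ 1 , -[1+ 1 ]) ∷
       (+ 2 , -1ℤ) ∷ (+ 2 , + 0) ∷ (+ 1 , + 1) ∷ (+ 0 , + 1) ∷ (+ 2 , + 1) ∷ (+ 1 , + 2) ∷
       (+ 3 , + 0) ∷ (+ 2 , + 2) ∷ (+ 3 , + 1) ∷ []) refl

  X⁺ : ∀ {x} → 0ℤ < x → X x
  X⁺ 0<x = X↑ (inX origin) (<⇒≤ 0<x)

  Y⁺ : ∀ {y} → 0ℤ < y → Y y
  Y⁺ 0<y = Y↑ (inY origin) (<⇒≤ 0<y)

  off⁺ : ∀ {t} → 0ℤ < t → t < s → on (a t) ≡ false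
  off⁺ 0<t t<s = off _ (<⇒≢ 0<t ∘ sym) t<s

  off⁻ : ∀ {t} → t < 0ℤ → on (a t) ≡ false
  off⁻ t<0 = off _ (<⇒≢ t<0) (<-trans t<0 0<s)

  -- Line indices and occupancy enter as equations, so a square can be read with whatever is known
  -- about its four lines.
  weakly : ∀ {δ σ p q u v} x y → x - y ≡ δ → x + y ≡ σ → X x → Y y →
    on (c x) ≡ p → on (r y) ≡ q → on (d δ) ≡ u → on (a σ) ≡ v → allowed p q u v ≡ true
  weakly x y refl refl x∈ y∈ refl refl refl refl = weak x y x∈ y∈

  strongly : ∀ {δ σ p q u v x′ y′} → HasQueen x′ y′ →
    ∀ x y → x - y ≡ δ → x + y ≡ σ → X x → Y y → (x , y) ≢ (x′ , y′) → Share x y x′ y′ →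
    on (c x) ≡ p → on (r y) ≡ q → on (d δ) ≡ u → on (a σ) ≡ v → odd p q u v ≡ true
  strongly Q x y refl refl x∈ y∈ z≢w sh refl refl refl refl = strong Q x y x∈ y∈ z≢w sh

  x≢0 : ∀ {x y} → 0ℤ < x → _≢_ {A = Cell} (x , y) (0ℤ , 0ℤ)
  x≢0 0<x eq = <⇒≢ 0<x (sym (,-injectiveˡ eq))

  -- The square (t, 0) lies on the occupied row 0 and the empty antidiagonal t, so its other two
  -- lines agree. `upward` and `diagonal` read (0, t) and (t, t) in the same way.
  rightward : ∀ {t} → 0ℤ < t → t < s → on (c t) ≡ on (d t)
  rightward {t} 0<t t<s = odd-p1u0 (strongly origin t 0ℤ (i-0 t) (+-identityʳ t)
    (X⁺ 0<t) (inY origin) (x≢0 0<t) (inj₂ (inj₁ refl)) refl (onr origin) refl (off⁺ 0<t t<s))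

  upward : ∀ {t} → 0ℤ < t → t < s → on (r t) ≡ on (d (- t))
  upward {t} 0<t t<s = odd-1qu0 (strongly origin 0ℤ t (0-i t) (+-identityˡ t)
    (inX origin) (Y⁺ 0<t) (λ eq → <⇒≢ 0<t (sym (,-injectiveʳ eq))) (inj₁ refl)
    (onc origin) refl refl (off⁺ 0<t t<s))

  diagonal : ∀ {t} → 0ℤ < t → t + t < s → on (c t) ≡ on (r t)
  diagonal {t} 0<t 2t<s = odd-pq10 (strongly origin t t (+-inverseʳ t) refl
    (X⁺ 0<t) (Y⁺ 0<t) (x≢0 0<t) (inj₂ (inj₂ (inj₁ (+-inverseʳ t))))
    refl refl (ond origin) (off⁺ (+-mono-< 0<t 0<t) 2t<s))

  -- Second queen northeast of the origin

  module NorthEast {x y} (Q : HasQueen x y) (x+y≡s : x + y ≡ s) (0<y : 0ℤ < y) (y<x : y < x) where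

    e : ℤ
    e = x - y

    0<e : 0ℤ < e
    0<e = difference>0 y<x

    0<x : 0ℤ < x
    0<x = <-trans 0<y y<x

    x<s : x < s
    x<s = gap y 0<y x+y≡s

    y<s : y < s
    y<s = gap x 0<x (trans (+-comm y x) x+y≡s)

    e<x : e < x
    e<x = gap y 0<y (trans (+-comm e y) (difference+ y x))

    2y<s : y + y < s
    2y<s = subst (y + y <_) x+y≡s (+-monoˡ-< y y<x)

    d-y : on (d (- y)) ≡ true
    d-y = trans (sym (upward 0<y y<s)) (onr Q)

    cy : on (c y) ≡ true
    cy = trans (diagonal 0<y 2y<s) (onr Q)

    ce : on (c e) ≡ true
    ce = trans (rightward 0<e (<-trans e<x x<s)) (ond Q)

    y-x≡-e : ∀ x y → y - x ≡ - (x - y)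
    y-x≡-e = solve-∀

    x-y-x≡-y : ∀ x y → x - y - x ≡ - y
    x-y-x≡-y = solve-∀

    -- At (y, x), on antidiagonal s, column y and diagonal -e are occupied, so row x is empty. Then
    -- (e, x), whose antidiagonal is below s, has exactly two occupied lines: column e and diagonal
    -- -y.
    low : e < y → ⊥
    low e<y = contradiction (weakly e x (x-y-x≡-y x y) refl (X⁺ 0<e) (Y⁺ 0<x)
        ce rx d-y (off⁺ (+-mono-< 0<e 0<x) e+x<s)) λ ()
      where
      e+x<s : e + x < s
      e+x<s = subst (e + x <_) (trans (+-comm y x) x+y≡s) (+-monoˡ-< x e<y)

      2e<s : e + e < s
      2e<s = <-trans (+-monoʳ-< e e<x) e+x<s

      d-e : on (d (- e)) ≡ true
      d-e = trans (sym (upward 0<e (<-trans e<x x<s))) (trans (sym (diagonal 0<e 2e<s)) ce)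

      rx : on (r x) ≡ false
      rx = odd-1q11 (strongly Q y x (y-x≡-e x y) (trans (+-comm y x) x+y≡s) (X⁺ 0<y) (Y⁺ 0<x)
        (λ eq → <⇒≢ y<x (,-injectiveˡ eq)) (inj₂ (inj₂ (inj₂ (+-comm y x)))) cy refl d-e on-s)

    -- Subtracting y twice from the diagonal e, as in Euclid's algorithm, occupies diagonal e - 2y,
    -- and (y, 2y) forces row 2y. Then all four lines through (e, 2y) are occupied, although the
    -- queen attacks this square along antidiagonal s.
    high : y < e → ⊥
    high y<e = contradiction (strongly Q e (y + y) refl (trans (e+2y x y) x+y≡s) (X⁺ 0<e) (Y⁺ 0<2y)
        (λ eq → <⇒≢ e<x (,-injectiveˡ eq)) (inj₂ (inj₂ (inj₂ (e+2y x y)))) ce r2y d[e-2y] on-s) λ ()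
      where
      e+2y : ∀ x y → x - y + (y + y) ≡ x + y
      e+2y = solve-∀

      y-2y : ∀ y → y - (y + y) ≡ - y
      y-2y = solve-∀

      e-y-y : ∀ x y → x - y - y - y ≡ x - y - (y + y)
      e-y-y = solve-∀

      cancel : ∀ i y → i - y + y ≡ i
      cancel = solve-∀

      0<2y : 0ℤ < y + y
      0<2y = +-mono-< 0<y 0<y

      0<e-y : 0ℤ < e - y
      0<e-y = difference>0 y<e

      3y<s : y + (y + y) < s
      3y<s = subst (y + (y + y) <_) (trans (e+2y x y) x+y≡s) (+-monoˡ-< (y + y) y<e)

      r2y : on (r (y + y)) ≡ true
      r2y = allowed-1q10 (weakly y (y + y) (y-2y y) refl (X⁺ 0<y) (Y⁺ 0<2y)
        cy refl d-y (off⁺ (+-mono-< 0<y 0<2y) 3y<s))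

      d[e-y] : on (d (e - y)) ≡ true
      d[e-y] = allowed-11u0 (weakly e y refl (cancel x y) (X⁺ 0<e) (Y⁺ 0<y)
        ce (onr Q) refl (off⁺ 0<x x<s))

      c[e-y] : on (c (e - y)) ≡ true
      c[e-y] = trans (rightward 0<e-y (<-trans (gap y 0<y (cancel e y)) (<-trans e<x x<s))) d[e-y]

      d[e-2y] : on (d (e - (y + y))) ≡ true
      d[e-2y] = allowed-11u0 (weakly (e - y) y (e-y-y x y) (cancel e y) (X⁺ 0<e-y) (Y⁺ 0<y)
        c[e-y] (onr Q) refl (off⁺ 0<e (<-trans e<x x<s)))

    impossible : ⊥
    impossible with <-cmp e y
    ... | tri< e<y _ _ = low e<y
    ... | tri> _ _ y<e = high y<e
    ... | tri≈ _ e≡y _ = ne-double y {{positive 0<y}}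
        (trans (triple y) (trans (cong (_+ y) 2y≡x) x+y≡s))
        (subst₂ HasQueen (sym (trans (double y) 2y≡x)) (sym (*-identityˡ y)) Q)
        (inY origin)
      where
      double : ∀ y → + 2 * y ≡ y + y
      double = solve-∀

      triple : ∀ y → + 3 * y ≡ y + y + y
      triple = solve-∀

      2y≡x : y + y ≡ x
      2y≡x = trans (cong (λ t → y + t) (sym e≡y)) (difference+ y x)

  -- Second queen southeast of the origin

  module SouthEast {k} (Q : HasQueen (s + k) (- k)) (0<k : 0ℤ < k) where

    s+k-k : ∀ s k → s + k + - k ≡ s
    s+k-k = solve-∀

    f+s-f : ∀ f s → s - f + f ≡ s
    f+s-f = solve-∀

    Y⁻ : ∀ {j} → j ≤ k → Y (- j)
    Y⁻ j≤k = Y↑ (inY Q) (neg-mono-≤ j≤k)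

    above : ∀ {x y} → 0ℤ < y → _≢_ {A = Cell} (x , y) (s + k , - k)
    above 0<y eq = <⇒≢ (<-trans (neg-mono-< 0<k) 0<y) (sym (,-injectiveʳ eq))

    onSecond : ∀ {x y} → x + y ≡ s → Share x y (s + k) (- k)
    onSecond x+y≡s = inj₂ (inj₂ (inj₂ (trans x+y≡s (sym (s+k-k s k)))))

    -- The counterpart of `upward` below the origin, where every antidiagonal is empty; the row -k
    -- of `Q` guarantees the rows above it.
    downward : ∀ {j} → 0ℤ < j → j ≤ k → on (r (- j)) ≡ on (d j)
    downward {j} 0<j j≤k = odd-1qu0 (strongly origin 0ℤ (- j) (0--i j) (+-identityˡ (- j))
      (inX origin) (Y⁻ j≤k) (λ eq → <⇒≢ (neg-mono-< 0<j) (,-injectiveʳ eq)) (inj₁ refl)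
      (onc origin) refl refl (off⁻ (neg-mono-< 0<j)))

    dk : on (d k) ≡ true
    dk = trans (sym (downward 0<k ≤-refl)) (onr Q)

    -- Shifting along the column f of a queen: below the second antidiagonal no
    -- antidiagonal except 0 is occupied.
    module Gap {f} (0<f : 0ℤ < f) (f<s : f < s) (df : on (d f) ≡ true) where

      cf : on (c f) ≡ true
      cf = trans (rightward 0<f f<s) df

      shift : ∀ {j} → 0ℤ < j → j ≤ k → j ≢ f → on (d j) ≡ on (d (f + j))
      shift {j} 0<j j≤k j≢f = trans (sym (downward 0<j j≤k))
        (allowed-1qu0 (weakly f (- j) (i--j f j) refl (X⁺ 0<f) (Y⁻ j≤k) cf refl refl
          (off (f - j) (λ eq → j≢f (sym (i-j≡0⇒i≡j f j eq)))
            (<-trans (gap j 0<j (f+s-f j f)) f<s))))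

      rf : f + f < s → on (r f) ≡ true
      rf 2f<s = trans (sym (diagonal 0<f 2f<s)) cf

      module _ (f≤k : f ≤ k) where

        -- The exception to `shift`: at (f, -f) column, row and the antidiagonal 0 are all occupied,
        -- which leaves the diagonal empty.
        d2f : on (d (f + f)) ≡ false
        d2f = odd-11u1 (strongly origin f (- f) (i--j f f) (+-inverseʳ f) (X⁺ 0<f) (Y⁻ f≤k)
          (x≢0 0<f) (inj₂ (inj₂ (inj₂ (+-inverseʳ f)))) cf (trans (downward 0<f f≤k) df) refl (ona origin))

        skip : ∀ {j} → f < j → j ≤ k → on (d j) ≡ false → on (d (f + j)) ≡ false
        skip f<j j≤k dj = trans (sym (shift (<-trans 0<f f<j) j≤k (<⇒≢ f<j ∘ sym))) dj

    2i-i : ∀ i → i + i - i ≡ i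
    2i-i = solve-∀

    s-f-f : ∀ s f → s - f - f ≡ s - (f + f)
    s-f-f = solve-∀

    f+[s-2f] : ∀ s f → f + (s - (f + f)) ≡ s - f
    f+[s-2f] = solve-∀

    2f-s : ∀ s f → f - (s - f) ≡ f + f - s
    2f-s = solve-∀

    s-f+[2f-s] : ∀ s f → s - f + (f + f - s) ≡ f
    s-f+[2f-s] = solve-∀

    -- Otherwise (2f, f) has exactly two occupied lines, row f and diagonal f: column 2f is empty
    -- along with diagonal 2f, and antidiagonal 3f lies below s.
    3f≮s : ∀ {f} (0<f : 0ℤ < f) → f ≤ k → on (d f) ≡ true → f + f < s → ¬ f + f + f < s
    3f≮s {f} 0<f f≤k df 2f<s 3f<s =
      contradiction (weakly (f + f) f (2i-i f) refl (X⁺ 0<2f) (Y⁺ 0<f)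
        (trans (rightward 0<2f 2f<s) (d2f f≤k)) (rf 2f<s) df
        (off⁺ (+-mono-< 0<2f 0<f) 3f<s)) λ ()
      where
      0<2f : 0ℤ < f + f
      0<2f = +-mono-< 0<f 0<f
      open Gap 0<f (<-trans (gap f 0<f refl) 2f<s) df

    -- At (s - f, f) row and antidiagonal are occupied, so column s - f and diagonal s - 2f differ.
    -- But column s - f agrees with diagonal s - f, which is diagonal s - 2f shifted by f.
    s≮3f : ∀ {f} (0<f : 0ℤ < f) → f ≤ k → on (d f) ≡ true → f + f < s → ¬ s < f + f + f
    s≮3f {f} 0<f f≤k df 2f<s s<3f = not-fixed (trans (sym c≡d) (odd-p1u1
        (strongly Q (s - f) f (s-f-f s f) (f+s-f f s) (X⁺ 0<s-f) (Y⁺ 0<f)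
          (above 0<f) (onSecond (f+s-f f s)) refl (rf 2f<s) refl on-s)))
      where
      f<s : f < s
      f<s = <-trans (gap f 0<f refl) 2f<s

      open Gap 0<f f<s df

      e : ℤ
      e = s - (f + f)

      e<f : e < f
      e<f = subst (e <_) (3f-2f f) (+-monoˡ-< (- (f + f)) s<3f)
        where
        3f-2f : ∀ f → f + f + f - (f + f) ≡ f
        3f-2f = solve-∀

      0<s-f : 0ℤ < s - f
      0<s-f = difference>0 f<s

      c≡d : on (c (s - f)) ≡ on (d e)
      c≡d = trans (rightward 0<s-f (gap f 0<f (f+s-f f s)))
        (trans (cong (on ∘ d) (sym (f+[s-2f] s f)))
          (sym (shift (difference>0 2f<s) (≤-trans (<⇒≤ e<f) f≤k) (<⇒≢ e<f))))

    -- With e = s - f and h = f - e, exactly one of the diagonals e and h is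
    -- occupied; shifting along its column turns it into the diagonal f = e + h
    -- and makes the other one occupied too.
    s≮2f : ∀ {f} (0<f : 0ℤ < f) → f < s → f ≤ k → on (d f) ≡ true → ¬ s < f + f
    s≮2f {f} 0<f f<s f≤k df s<2f = split (on (d e)) refl
      where
      open Gap 0<f f<s df

      e h : ℤ
      e = s - f
      h = f + f - s

      0<e : 0ℤ < e
      0<e = difference>0 f<s

      0<h : 0ℤ < h
      0<h = difference>0 s<2f

      e+h≡f : e + h ≡ f
      e+h≡f = s-f+[2f-s] s f

      h+e≡f : h + e ≡ f
      h+e≡f = trans (+-comm h e) e+h≡f

      e<f : e < f
      e<f = gap h 0<h e+h≡f

      h<f : h < f
      h<f = gap e 0<e h+e≡f

      2e<s : e + e < s
      2e<s = subst (e + e <_) (f+s-f f s) (+-monoʳ-< e e<f)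

      de≡dh : on (d e) ≡ not (on (d h))
      de≡dh = trans (sym (rightward 0<e (<-trans e<f f<s))) (trans (diagonal 0<e 2e<s)
        (odd-1qu1 (strongly Q f e (2f-s s f) (difference+ f s) (X⁺ 0<f) (Y⁺ 0<e)
          (above 0<e) (onSecond (difference+ f s)) cf refl refl on-s)))

      e≢h : e ≢ h
      e≢h e≡h = not-fixed (trans (cong (on ∘ d) (sym e≡h)) de≡dh)

      split : ∀ b → on (d e) ≡ b → ⊥
      split true de = contradiction (trans (sym de) (trans de≡dh (cong not dh))) λ ()
        where
        dh : on (d h) ≡ true
        dh = trans (Gap.shift 0<e (<-trans e<f f<s) de 0<h (≤-trans (<⇒≤ h<f) f≤k) (e≢h ∘ sym))
          (trans (cong (on ∘ d) e+h≡f) df)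
      split false de = contradiction (trans (sym de) (trans
          (Gap.shift 0<h (<-trans h<f f<s) dh 0<e (≤-trans (<⇒≤ e<f) f≤k) e≢h)
          (trans (cong (on ∘ d) h+e≡f) df))) λ ()
        where
        dh : on (d h) ≡ true
        dh = not-injective (trans (sym de≡dh) de)

    -- These are the proportions not excluded above. `close` takes f = k and `middle` takes f = 2s -
    -- k.
    multiple : ∀ {f} (0<f : 0ℤ < f) → f < s → f ≤ k → on (d f) ≡ true → f + f ≡ s ⊎ f + f + f ≡ s
    multiple {f} 0<f f<s f≤k df with <-cmp (f + f) s
    ... | tri≈ _ eq _ = inj₁ eq
    ... | tri> _ _ s<2f = contradiction s<2f (s≮2f 0<f f<s f≤k df)
    ... | tri< 2f<s _ _ with <-cmp (f + f + f) s
    ...   | tri≈ _ eq _ = inj₂ eq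
    ...   | tri< 3f<s _ _ = contradiction 3f<s (3f≮s 0<f f≤k df 2f<s)
    ...   | tri> _ _ s<3f = contradiction s<3f (s≮3f 0<f f≤k df 2f<s)

    scaled : ∀ {g i} → i * g ≡ s + k → -1ℤ * g ≡ - k → HasQueen (i * g) (-1ℤ * g)
    scaled eq eq′ = subst₂ HasQueen (sym eq) (sym eq′) Q

    2* : ∀ i → + 2 * i ≡ i + i
    2* = solve-∀

    3* : ∀ i → + 3 * i ≡ i + i + i
    3* = solve-∀

    4* : ∀ i → + 4 * i ≡ i + i + i + i
    4* = solve-∀

    close : k < s → ⊥
    close k<s with multiple 0<k k<s ≤-refl dk
    ... | inj₁ 2k≡s = se-half k {{positive 0<k}} (trans (2* k) 2k≡s)
      (scaled {k} {+ 3} (trans (3* k) (cong (_+ k) 2k≡s)) (-1*i≡-i k))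
    ... | inj₂ 3k≡s = se-third k {{positive 0<k}} (trans (3* k) 3k≡s)
      (scaled {k} {+ 4} (trans (4* k) (cong (_+ k) 3k≡s)) (-1*i≡-i k))

    equal : k ≡ s → ⊥
    equal k≡s = se-equal s {{positive 0<s}} (*-identityˡ s)
      (scaled {s} {+ 2} (trans (2* s) (cong (λ t → s + t) (sym k≡s))) (trans (-1*i≡-i s) (cong -_ (sym k≡s))))

    far : s + s ≤ k → ⊥
    far 2s≤k = deep s {{positive 0<s}} (*-identityˡ s) (subst Y (-2* s) (Y⁻ 2s≤k))
      where
      -2* : ∀ i → - (i + i) ≡ -[1+ 1 ] * i
      -2* = solve-∀

    -- Since k > s, `multiple` is applied to f = 2s - k instead. It makes k equal to 3f or 5f, and
    -- the emptiness of diagonal 2f is passed on in steps of f up to diagonal k, which is occupied.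
    middle : s < k → k < s + s → ⊥
    middle s<k k<2s = finish (multiple 0<f f<s (<⇒≤ (<-trans f<s s<k)) df)
      where
      f : ℤ
      f = s + s - k

      0<f : 0ℤ < f
      0<f = difference>0 k<2s

      f+[k-s] : ∀ s k → s + s - k + (k - s) ≡ s
      f+[k-s] = solve-∀

      f<s : f < s
      f<s = gap (k - s) (difference>0 s<k) (f+[k-s] s k)

      f≤k : f ≤ k
      f≤k = <⇒≤ (<-trans f<s s<k)

      f+k≡2s : f + k ≡ s + s
      f+k≡2s = trans (+-comm f k) (difference+ k (s + s))

      cs≡ds : on (c s) ≡ not (on (d s))
      cs≡ds = odd-p1u1 (strongly origin s 0ℤ (i-0 s) (+-identityʳ s) (X⁺ 0<s) (inY origin)
        (x≢0 0<s) (inj₂ (inj₁ refl)) refl (onr origin) refl on-s)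

      -- At (s, -s) the row agrees with diagonal s, so exactly one of column and row is occupied,
      -- whichever it is. As antidiagonal 0 is occupied too, parity forces the diagonal.
      d2s : on (d (s + s)) ≡ true
      d2s = odd-not {on (d s)} (strongly origin s (- s) (i--j s s) (+-inverseʳ s) (X⁺ 0<s) (Y⁻ (<⇒≤ s<k))
        (x≢0 0<s) (inj₂ (inj₂ (inj₂ (+-inverseʳ s)))) cs≡ds (downward 0<s (<⇒≤ s<k)) refl (ona origin))

      -- At (f, -k) row -k and diagonal f + k = 2s are occupied and the antidiagonal is negative, so
      -- column f must be the third line.
      df : on (d f) ≡ true
      df = trans (sym (rightward 0<f f<s)) (allowed-p110 (weakly f (- k) (i--j f k) refl
        (X⁺ 0<f) (Y⁻ ≤-refl) refl (onr Q) (trans (cong (on ∘ d) f+k≡2s) d2s)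
        (off⁻ f-k<0)))
        where
        f-k<0 : f - k < 0ℤ
        f-k<0 = subst (f - k <_) (+-inverseʳ k) (+-monoˡ-< (- k) (<-trans f<s s<k))

      open Gap 0<f f<s df

      k≡2s-f : ∀ s k → k ≡ s + s - (s + s - k)
      k≡2s-f = solve-∀

      finish : f + f ≡ s ⊎ f + f + f ≡ s → ⊥
      finish (inj₁ 2f≡s) = contradiction (trans (sym dk) (trans (cong (on ∘ d) k≡3f)
          (skip f≤k (gap f 0<f refl) (subst (_≤ k) (sym 2f≡s) (<⇒≤ s<k)) (d2f f≤k)))) λ ()
        where
        2s-f : ∀ f → f + f + (f + f) - f ≡ f + (f + f)
        2s-f = solve-∀

        k≡3f : k ≡ f + (f + f)
        k≡3f = trans (k≡2s-f s k) (trans (cong (λ s → s + s - f) (sym 2f≡s)) (2s-f f))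
      finish (inj₂ 3f≡s) = contradiction (trans (sym dk) (trans (cong (on ∘ d) k≡5f)
          (skip f≤k f<4f 4f≤k (skip f≤k f<3f (≤-trans (<⇒≤ 3f<4f) 4f≤k)
            (skip f≤k (gap f 0<f refl) (≤-trans (<⇒≤ 2f<3f) (≤-trans (<⇒≤ 3f<4f) 4f≤k)) (d2f f≤k)))))) λ ()
        where
        2s-f : ∀ f → f + f + f + (f + f + f) - f ≡ f + (f + (f + (f + f)))
        2s-f = solve-∀

        k≡5f : k ≡ f + (f + (f + (f + f)))
        k≡5f = trans (k≡2s-f s k) (trans (cong (λ s → s + s - f) (sym 3f≡s)) (2s-f f))

        2f<3f : f + f < f + (f + f)
        2f<3f = gap f 0<f (+-comm (f + f) f)

        3f<4f : f + (f + f) < f + (f + (f + f))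
        3f<4f = gap f 0<f (+-comm (f + (f + f)) f)

        f<3f : f < f + (f + f)
        f<3f = <-trans (gap f 0<f refl) 2f<3f

        f<4f : f < f + (f + (f + f))
        f<4f = <-trans f<3f 3f<4f

        4f≤k : f + (f + (f + f)) ≤ k
        4f≤k = <⇒≤ (gap f 0<f (trans (+-comm _ f) (sym k≡5f)))

    impossible : ⊥
    impossible with <-cmp k s
    ... | tri< k<s _ _ = close k<s
    ... | tri≈ _ k≡s _ = equal k≡s
    ... | tri> _ _ s<k with <-cmp k (s + s)
    ...   | tri< k<2s _ _ = middle s<k k<2s
    ...   | tri≈ _ k≡2s _ = far (≤-reflexive (sym k≡2s))
    ...   | tri> _ _ 2s<k = far (<⇒≤ 2s<k)

  not-both>0 : ∀ {x y} → HasQueen x y → x + y ≡ s → 0ℤ < y → y < x → ⊥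
  not-both>0 Q x+y≡s 0<y y<x = NorthEast.impossible Q x+y≡s 0<y y<x

  not-below : ∀ {x y} → HasQueen x y → x + y ≡ s → y < 0ℤ → ⊥
  not-below {x} {y} Q x+y≡s y<0 = SouthEast.impossible
    (subst₂ HasQueen (trans (x≡x+y-y x y) (cong (_+ - y) x+y≡s)) (sym (neg-involutive y)) Q)
    (neg-mono-< y<0)
    where
    x≡x+y-y : ∀ x y → x ≡ x + y - y
    x≡x+y-y = solve-∀

-- Reduction to the two lowest antidiagonals

module _ (M : Model) where

  open Model M

  -- All four lines through a queen are occupied, an even number, against the odd rule that a
  -- different queen on a common line would impose there.
  separate : ∀ {x y x′ y′} → HasQueen x y → HasQueen x′ y′ → Share x y x′ y′ → x ≡ x′ × y ≡ y′
  separate {x} {y} {x′} {y′} Q Q′ sh with ×-≡-dec _≟_ _≟_ (x , y) (x′ , y′)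
  ... | yes eq = ,-injectiveˡ eq , ,-injectiveʳ eq
  ... | no z≢w with strong Q′ x y (inX Q) (inY Q) z≢w sh
  ...   | h rewrite onc Q | onr Q | ond Q | ona Q = contradiction h λ ()

  -- A queen on an axis or on the main diagonal shares a line with the origin. The other positions
  -- with positive sum fall under `Corner`, up to reflection.
  no-second : HasQueen 0ℤ 0ℤ →
    (∀ {x x′} → X x → x ≤ x′ → X x′) → (∀ {y y′} → Y y → y ≤ y′ → Y y′) →
    ∀ {x y} → HasQueen x y → 0ℤ < x + y → (∀ t → t ≢ 0ℤ → t < x + y → on (a t) ≡ false) → ⊥
  no-second O X↑ Y↑ {x} {y} Q 0<s off with <-cmp y 0ℤ | <-cmp x 0ℤ
  ... | tri< y<0 _ _ | _ = Corner.not-below M O X↑ Y↑ (x + y) 0<s (ona Q) off Q refl y<0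
  ... | tri≈ _ y≡0 _ | _ =
    <⇒≢ 0<s (sym (cong₂ _+_ (proj₁ (separate Q O (inj₂ (inj₁ y≡0)))) y≡0))
  ... | tri> _ _ 0<y | tri< x<0 _ _ =
    Corner.not-below (mirror M) O Y↑ X↑ (x + y) 0<s (ona Q) off Q (+-comm y x) x<0
  ... | tri> _ _ 0<y | tri≈ _ x≡0 _ =
    <⇒≢ 0<s (sym (cong₂ _+_ x≡0 (proj₂ (separate Q O (inj₁ x≡0)))))
  ... | tri> _ _ 0<y | tri> _ _ 0<x with <-cmp y x
  ...   | tri< y<x _ _ = Corner.not-both>0 M O X↑ Y↑ (x + y) 0<s (ona Q) off Q refl 0<y y<x
  ...   | tri≈ _ y≡x _ = <⇒≢ 0<x (sym (proj₁ (separate Q O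
    (inj₂ (inj₂ (inj₁ (trans (cong (λ t → x - t) y≡x) (+-inverseʳ x))))))))
  ...   | tri> _ _ x<y =
    Corner.not-both>0 (mirror M) O Y↑ X↑ (x + y) 0<s (ona Q) off Q (+-comm y x) 0<x x<y

least : ∀ (f : ℕ.ℕ → Bool) n → f n ≡ true → ∃[ m ] f m ≡ true × ∀ {i} → i ℕ.< m → f i ≡ false
least f n fn with f 0 in f0
... | true = 0 , f0 , λ ()
least f ℕ.zero fn | false = contradiction (trans (sym f0) fn) λ ()
least f (ℕ.suc n) fn | false with least (f ∘ ℕ.suc) n fn
... | m , fm , below = ℕ.suc m , fm , λ { {ℕ.zero} _ → f0 ; {ℕ.suc i} (ℕ.s≤s i<m) → below i<m }

positive-form : ∀ {i} → 0ℤ < i → ∃[ n ] i ≡ + ℕ.suc n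
positive-form {+ ℕ.suc n} _ = n , refl
positive-form {+ 0} (+<+ ())

-- Finds the next occupied antidiagonal: `on` is Boolean, and a known occupied one bounds the
-- search.
least-above : ∀ (f : ℤ → Bool) b {t} → b < t → f t ≡ true →
  ∃[ m ] b < m × f m ≡ true × ∀ {i} → b < i → i < m → f i ≡ false
least-above f b {t} b<t ft with positive-form (difference>0 b<t)
-- The search starts at b + 1, so index n stands for b + (n + 1).
... | n , t-b≡n with least (λ n → f (b + + ℕ.suc n)) n
    (trans (cong f (trans (cong (λ i → b + i) (sym t-b≡n)) (difference+ b t))) ft)
...   | m , fm , below = b + + ℕ.suc m , gap (+ ℕ.suc m) (+<+ (ℕ.s≤s ℕ.z≤n)) refl , fm , off
  where
  off : ∀ {i} → b < i → i < b + + ℕ.suc m → f i ≡ false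
  off {i} b<i i<m with positive-form (difference>0 b<i)
  ... | j , i-b≡j with j ℕ.<? m | trans (cong (λ i → b + i) (sym i-b≡j)) (difference+ b i)
  ...   | yes j<m | refl = below j<m
  ...   | no  j≮m | refl =
    contradiction (+-monoʳ-≤ b (+≤+ (ℕ.s≤s (ℕ.≮⇒≥ j≮m)))) (<⇒≱ i<m)

-- Kept out of `Model` because `scale` need not preserve it: a line of the sublattice may be
-- occupied by a queen off the sublattice.
FindsAntidiagonals FindsDiagonals : Model → Set
FindsAntidiagonals M = ∀ {t} → on (a t) ≡ true → ∃₂ λ x y → HasQueen x y × x + y ≡ t
  where open Model M
FindsDiagonals M = ∀ {t} → on (d t) ≡ true → ∃₂ λ x y → HasQueen x y × x - y ≡ t
  where open Model M

module Quadrant (M : Model)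
  (X↑ : ∀ {x x′} → Model.X M x → x ≤ x′ → Model.X M x′)
  (Y↑ : ∀ {y y′} → Model.Y M y → y ≤ y′ → Model.Y M y′)
  (antidiagonal : FindsAntidiagonals M)
  (positive-sum : ∀ {x y} → Model.HasQueen M x y → 0ℤ < x + y) where

  open Model M

  off-below : ∀ {t} → t ≤ 0ℤ → on (a t) ≡ false
  off-below {t} t≤0 with on (a t) in eq
  ... | false = refl
  ... | true with antidiagonal eq
  ...   | x , y , Q , refl = contradiction (positive-sum Q) (≤⇒≯ t≤0)

  module FromLowest {p q} (P : HasQueen p q) (lowest : ∀ {t} → t < p + q → on (a t) ≡ false) where

    M₀ : Model
    M₀ = translate M p q

    module M₀ = Model M₀

    origin : M₀.HasQueen 0ℤ 0ℤ
    origin = subst₂ HasQueen (sym (+-identityʳ p)) (sym (+-identityʳ q)) P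

    conclude : ∀ {x y} → HasQueen x y → p + q < x + y →
      (∀ t → t ≢ 0ℤ → t < x + y - (p + q) → on (a (p + q + t)) ≡ false) → ⊥
    conclude {x} {y} Q p+q<x+y off = no-second M₀ origin
      (λ x∈ x≤x′ → X↑ x∈ (+-monoʳ-≤ p x≤x′)) (λ y∈ y≤y′ → Y↑ y∈ (+-monoʳ-≤ q y≤y′))
      (subst₂ HasQueen (sym (difference+ p x)) (sym (difference+ q y)) Q)
      (subst (0ℤ <_) (sym (rearrange p q x y)) (difference>0 p+q<x+y))
      (λ t t≢0 t< → off t t≢0 (subst (t <_) (rearrange p q x y) t<))
      where
      rearrange : ∀ p q x y → x - p + (y - q) ≡ x + y - (p + q)
      rearrange = solve-∀

    above : ∀ {x y} → HasQueen x y → ¬ p + q < x + y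
    above Q σ<τ with least-above (on ∘ a) (p + q) σ<τ (ona Q)
    ... | _ , σ<μ , on-μ , off with antidiagonal on-μ
    ...   | x , y , R , refl = conclude R σ<μ offset
      where
      offset : ∀ t → t ≢ 0ℤ → t < x + y - (p + q) → on (a (p + q + t)) ≡ false
      offset t t≢0 t<s with <-cmp t 0ℤ
      ... | tri< t<0 _ _ = lowest (subst (p + q + t <_) (+-identityʳ (p + q)) (+-monoʳ-< (p + q) t<0))
      ... | tri≈ _ t≡0 _ = contradiction t≡0 t≢0
      ... | tri> _ _ 0<t = off (gap t 0<t refl)
        (subst (p + q + t <_) (difference+ (p + q) (x + y)) (+-monoʳ-< (p + q) t<s))

  at-most-one : ∀ {x y x′ y′} → HasQueen x y → HasQueen x′ y′ → x ≡ x′ × y ≡ y′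
  -- Queens have positive sums, so the first occupied antidiagonal beyond 0 is the lowest of all.
  at-most-one {x} {y} Q Q′ with least-above (on ∘ a) 0ℤ (positive-sum Q) (ona Q)
  ... | _ , 0<σ , on-σ , off with antidiagonal on-σ
  ...   | p , q , P , refl = trans (proj₁ (same Q)) (sym (proj₁ (same Q′))) ,
                             trans (proj₂ (same Q)) (sym (proj₂ (same Q′)))
    where
    lowest : ∀ {t} → t < p + q → on (a t) ≡ false
    lowest {t} t<σ with t ≤? 0ℤ
    ... | yes t≤0 = off-below t≤0
    ... | no  t≰0 = off (≰⇒> t≰0) t<σ

    same : ∀ {x y} → HasQueen x y → x ≡ p × y ≡ q
    same {x} {y} Q with <-cmp (x + y) (p + q)
    ... | tri< τ<σ _ _ = contradiction (trans (sym (ona Q)) (lowest τ<σ)) λ ()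
    ... | tri≈ _ τ≡σ _ = separate M Q P (inj₂ (inj₂ (inj₂ τ≡σ)))
    ... | tri> _ _ σ<τ = contradiction σ<τ (FromLowest.above P lowest Q)

-- The plane

odd-p1uv : ∀ u v {p} → odd p true u v ≡ true → p ≡ u xor v
odd-p1uv true false {true} _ = refl
odd-p1uv false true {true} _ = refl
odd-p1uv true true {false} _ = refl
odd-p1uv false false {false} _ = refl

odd-1quv : ∀ u v {q} → odd true q u v ≡ true → q ≡ u xor v
odd-1quv true false {true} _ = refl
odd-1quv false true {true} _ = refl
odd-1quv true true {false} _ = refl
odd-1quv false false {false} _ = refl

odd-pq1v : ∀ p q {v} → odd p q true v ≡ true → v ≡ p xor q
odd-pq1v true true {false} _ = refl
odd-pq1v true false {true} _ = refl
odd-pq1v false true {true} _ = refl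
odd-pq1v false false {false} _ = refl

odd-pqu1 : ∀ p q {u} → odd p q u true ≡ true → u ≡ p xor q
odd-pqu1 true true {false} _ = refl
odd-pqu1 true false {true} _ = refl
odd-pqu1 false true {true} _ = refl
odd-pqu1 false false {false} _ = refl

odd-11uv : ∀ u v → odd true true u v ≡ true → u ≡ true ⊎ v ≡ true
odd-11uv true  false _ = inj₁ refl
odd-11uv false true  _ = inj₂ refl

xor-cancelʳ : ∀ u v w → (u xor w) xor (v xor w) ≡ u xor v
xor-cancelʳ true  true  true  = refl
xor-cancelʳ true  true  false = refl
xor-cancelʳ true  false true  = refl
xor-cancelʳ true  false false = refl
xor-cancelʳ false true  true  = refl
xor-cancelʳ false true  false = refl
xor-cancelʳ false false true  = refl
xor-cancelʳ false false false = refl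

-i-i : ∀ i → - i + - i ≡ - (i + i)
-i-i = solve-∀

i+i≢0 : ∀ {i} → i ≢ 0ℤ → i + i ≢ 0ℤ
i+i≢0 {i} i≢0 eq = i≢0 (*-cancelˡ-≡ (+ 2) i 0ℤ (trans (double i) eq))
  where
  double : ∀ i → + 2 * i ≡ i + i
  double = solve-∀

Even : ℤ → Set
Even i = ∃[ h ] i ≡ h + h

-- The pigeonhole principle for the parities of 0, i and j, applied to the antidiagonals of three
-- queens measured from the first.
even-of-three : ∀ i j → Even i ⊎ Even j ⊎ Even (j - i)
even-of-three i j with half i | half j
  where
  halfℕ : ∀ n → Even (+ n) ⊎ Even (+ ℕ.suc n)
  halfℕ ℕ.zero = inj₁ (0ℤ , refl)
  halfℕ (ℕ.suc n) with halfℕ n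
  ... | inj₁ (h , eq) = inj₂ (1ℤ + h , trans (cong (λ i → + 2 + i) eq) (shift h))
    where
    shift : ∀ h → + 2 + (h + h) ≡ 1ℤ + h + (1ℤ + h)
    shift = solve-∀
  ... | inj₂ even = inj₁ even

  half : ∀ i → Even i ⊎ ∃[ h ] 1ℤ + i ≡ h + h
  half (+ n) = halfℕ n
  half -[1+ n ] with halfℕ n
  ... | inj₁ (h , eq) = inj₂ (- h , trans (0-n n) (trans (cong -_ eq) (sym (-i-i h))))
    where
    0-n : ∀ n → 1ℤ + -[1+ n ] ≡ - (+ n)
    0-n ℕ.zero = refl
    0-n (ℕ.suc n) = refl
  ... | inj₂ (h , eq) = inj₁ (- h , trans (cong -_ eq) (sym (-i-i h)))
... | inj₁ even | _ = inj₁ even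
... | inj₂ _ | inj₁ even = inj₂ (inj₁ even)
... | inj₂ (h , eq) | inj₂ (h′ , eq′) =
  inj₂ (inj₂ (h′ - h , trans (shift i j) (trans (cong₂ _-_ eq′ eq) (regroup h h′))))
  where
  shift : ∀ i j → j - i ≡ 1ℤ + j - (1ℤ + i)
  shift = solve-∀

  regroup : ∀ h h′ → h′ + h′ - (h + h) ≡ h′ - h + (h′ - h)
  regroup = solve-∀

module Origin (M : Model)
  (X∀ : ∀ x → Model.X M x) (Y∀ : ∀ y → Model.Y M y) (origin : Model.HasQueen M 0ℤ 0ℤ) where

  open Model M

  module _ {t} (t≢0 : t ≢ 0ℤ) where

    at : ∀ {δ σ p q u v} x y → x - y ≡ δ → x + y ≡ σ → _≢_ {A = Cell} (x , y) (0ℤ , 0ℤ) → Share x y 0ℤ 0ℤ →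
      on (c x) ≡ p → on (r y) ≡ q → on (d δ) ≡ u → on (a σ) ≡ v → odd p q u v ≡ true
    at x y refl refl z≢0 sh refl refl refl refl = strong origin x y (X∀ x) (Y∀ y) z≢0 sh

    horizontal : on (c t) ≡ on (d t) xor on (a t)
    horizontal = odd-p1uv (on (d t)) (on (a t)) (at t 0ℤ (i-0 t) (+-identityʳ t) (t≢0 ∘ ,-injectiveˡ)
      (inj₂ (inj₁ refl)) refl (onr origin) refl refl)

    vertical : on (r t) ≡ on (d (- t)) xor on (a t)
    vertical = odd-1quv (on (d (- t))) (on (a t)) (at 0ℤ t (0-i t) (+-identityˡ t) (t≢0 ∘ ,-injectiveʳ)
      (inj₁ refl) (onc origin) refl refl refl)

    diagonal : on (a (t + t)) ≡ on (c t) xor on (r t)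
    diagonal = odd-pq1v (on (c t)) (on (r t)) (at t t (+-inverseʳ t) refl (t≢0 ∘ ,-injectiveˡ)
      (inj₂ (inj₂ (inj₁ (+-inverseʳ t)))) refl refl (ond origin) refl)

    antidiagonal : on (d (t + t)) ≡ on (c t) xor on (r (- t))
    antidiagonal = odd-pqu1 (on (c t)) (on (r (- t))) (at t (- t) (i--j t t) (+-inverseʳ t) (t≢0 ∘ ,-injectiveˡ)
      (inj₂ (inj₂ (inj₂ (+-inverseʳ t)))) refl refl refl (ona origin))

  -- Column t and row t are read at (t, 0) and (0, t), which share antidiagonal t, so its
  -- contribution cancels. In `d[2t]` diagonal t cancels between (t, 0) and (0, -t).
  a[2t] : ∀ {t} → t ≢ 0ℤ → on (a (t + t)) ≡ on (d t) xor on (d (- t))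
  a[2t] {t} t≢0 = trans (diagonal t≢0) (trans (cong₂ _xor_ (horizontal t≢0) (vertical t≢0))
    (xor-cancelʳ (on (d t)) _ (on (a t))))

  d[2t] : ∀ {t} → t ≢ 0ℤ → on (d (t + t)) ≡ on (a t) xor on (a (- t))
  d[2t] {t} t≢0 = trans (antidiagonal t≢0) (trans
    (cong₂ _xor_ (trans (horizontal t≢0) (xor-comm (on (d t)) _))
      (trans (vertical (t≢0 ∘ neg-injective))
        (trans (cong (λ i → on (d i) xor on (a (- t))) (neg-involutive t)) (xor-comm (on (d t)) _))))
    (xor-cancelʳ (on (a t)) _ (on (d t))))

  a-symmetric : ∀ {t} → t ≢ 0ℤ → on (a (- (t + t))) ≡ on (a (t + t))
  a-symmetric {t} t≢0 = trans (cong (on ∘ a) (sym (-i-i t))) (trans (a[2t] (t≢0 ∘ neg-injective))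
    (trans (cong (λ i → on (d (- t)) xor on (d i)) (neg-involutive t))
      (trans (xor-comm (on (d (- t))) _) (sym (a[2t] t≢0)))))

  d-symmetric : ∀ {t} → t ≢ 0ℤ → on (d (- (t + t))) ≡ on (d (t + t))
  d-symmetric {t} t≢0 = trans (cong (on ∘ d) (sym (-i-i t))) (trans (d[2t] (t≢0 ∘ neg-injective))
    (trans (cong (λ i → on (a (- t)) xor on (a i)) (neg-involutive t))
      (trans (xor-comm (on (a (- t))) _) (sym (d[2t] t≢0)))))

  a[4t] : ∀ {t} → t ≢ 0ℤ → on (a (t + t + (t + t))) ≡ false
  a[4t] {t} t≢0 = trans (a[2t] (i+i≢0 t≢0)) (trans (cong (on (d (t + t)) xor_) (d-symmetric t≢0))
    (xor-same (on (d (t + t)))))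

module Plane (M : Model) (X∀ : ∀ x → Model.X M x) (Y∀ : ∀ y → Model.Y M y)
  (findA : FindsAntidiagonals M) (findD : FindsDiagonals M) where

  open Model M

  module At {p q} (P : HasQueen p q) = Origin (translate M p q) (λ x → X∀ (p + x)) (λ y → Y∀ (q + y))
    (subst₂ HasQueen (sym (+-identityʳ p)) (sym (+-identityʳ q)) P)

  even-gap : ∀ {x y p q} → HasQueen x y → HasQueen p q → Even (x + y - (p + q)) → x ≡ p × y ≡ q
  even-gap {x} {y} {p} {q} Q P (t , gap≡2t) with t ≟ 0ℤ
  ... | yes refl = separate M Q P (inj₂ (inj₂ (inj₂ (i-j≡0⇒i≡j (x + y) (p + q) gap≡2t))))
  ... | no t≢0 with findA (trans (At.a-symmetric P t≢0) (trans (cong (on ∘ a) 2t-above) (ona Q)))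
    where
    2t-above : p + q + (t + t) ≡ x + y
    2t-above = trans (cong (λ i → p + q + i) (sym gap≡2t)) (difference+ (p + q) (x + y))
  ...   | u , v , R , u+v≡ = contradiction
    (trans (sym (ona Q)) (trans (cong (on ∘ a) (sym 4t-above)) (At.a[4t] R t≢0))) λ ()
    where
    regroup : ∀ σ t → σ - (t + t) + (t + t + (t + t)) ≡ σ + (t + t)
    regroup = solve-∀

    4t-above : u + v + (t + t + (t + t)) ≡ x + y
    4t-above = trans (cong (_+ (t + t + (t + t))) u+v≡) (trans (regroup (p + q) t)
      (trans (cong (λ i → p + q + i) (sym gap≡2t)) (difference+ (p + q) (x + y))))

  at-most-one : ∀ {x y x′ y′} → HasQueen x y → HasQueen x′ y′ → x ≡ x′ × y ≡ y′
  at-most-one {x} {y} {x′} {y′} P Q with x ≟ x′ | y ≟ y′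
  ... | yes x≡x′ | _ = separate M P Q (inj₁ x≡x′)
  ... | no _ | yes y≡y′ = separate M P Q (inj₂ (inj₁ y≡y′))
  ... | no x≢x′ | no y≢y′ = ⊥-elim (third corner)
    where
    -- The square in the column of `Q` and the row of `P` is attacked, so besides these two lines
    -- exactly one more is occupied.
    corner : on (d (x′ - y)) ≡ true ⊎ on (a (x′ + y)) ≡ true
    corner = odd-11uv _ _ (values (on (d (x′ - y))) (on (a (x′ + y))) (onc Q) (onr P) (strong P x′ y (X∀ x′) (Y∀ y)
        (x≢x′ ∘ sym ∘ ,-injectiveˡ) (inj₂ (inj₁ refl))))
      where
      values : ∀ u v {p q} → p ≡ true → q ≡ true → odd p q u v ≡ true → odd true true u v ≡ true
      values _ _ refl refl h = h

    neither : ∀ {u v} → HasQueen u v → ¬ (u ≡ x × v ≡ y) → ¬ (u ≡ x′ × v ≡ y′) → ⊥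
    neither {u} {v} R R≢P R≢Q with even-of-three (x′ + y′ - (x + y)) (u + v - (x + y))
    ... | inj₁ even = x≢x′ (sym (proj₁ (even-gap Q P even)))
    ... | inj₂ (inj₁ even) = R≢P (even-gap R P even)
    ... | inj₂ (inj₂ (h , eq)) = R≢Q (even-gap R Q (h , trans (sym (cancel (u + v) (x′ + y′) (x + y))) eq))
      where
      cancel : ∀ i j k → i - k - (j - k) ≡ i - j
      cancel = solve-∀

    -- `P` and `Q` share a row or column with the corner square and differ from it, so neither lies
    -- on its diagonals and the queen found is a third one.
    third : on (d (x′ - y)) ≡ true ⊎ on (a (x′ + y)) ≡ true → ⊥
    third (inj₁ on-d) with findD on-d
    ... | _ , _ , R , eq = neither R
      (λ { (refl , refl) → x≢x′ (+-cancelʳ (- y) x x′ eq) })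
      (λ { (refl , refl) → y≢y′ (sym (neg-injective (+-cancelˡ x′ (- y′) (- y) eq))) })
    third (inj₂ on-a) with findA on-a
    ... | _ , _ , R , eq = neither R
      (λ { (refl , refl) → x≢x′ (+-cancelʳ y x x′ eq) })
      (λ { (refl , refl) → y≢y′ (sym (+-cancelˡ x′ y′ y eq)) })

-- Queen graphs

parity : ℕ → Bool
parity ℕ.zero = false
parity (ℕ.suc n) = not (parity n)

parity-odd : ∀ n → n % 2 ≡ 1 → parity n ≡ true
parity-odd 1 _ = refl
parity-odd (ℕ.suc (ℕ.suc n)) eq = trans (not-involutive _) (parity-odd n eq)

exchange⁻ : ∀ x y x′ y′ → x - y ≡ x′ - y′ → x - x′ ≡ y - y′
exchange⁻ x y x′ y′ eq = trans (regroup x y x′ y′)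
  (trans (cong (_+ (y - y′)) (i≡j⇒i-j≡0 eq)) (+-identityˡ (y - y′)))
  where
  regroup : ∀ x y x′ y′ → x - x′ ≡ x - y - (x′ - y′) + (y - y′)
  regroup = solve-∀

exchange⁺ : ∀ x y x′ y′ → x + y ≡ x′ + y′ → x - x′ ≡ y′ - y
exchange⁺ x y x′ y′ eq = trans (regroup x y x′ y′)
  (trans (cong (_+ (y′ - y)) (i≡j⇒i-j≡0 eq)) (+-identityˡ (y′ - y)))
  where
  regroup : ∀ x y x′ y′ → x - x′ ≡ x + y - (x′ + y′) + (y′ - y)
  regroup = solve-∀

exchange⁺⁻¹ : ∀ x y x′ y′ → x - x′ ≡ y′ - y → x + y ≡ x′ + y′
exchange⁺⁻¹ x y x′ y′ eq = trans (regroup x y x′ y′)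
  (trans (cong (_+ (x′ + y′)) (i≡j⇒i-j≡0 eq)) (+-identityˡ (x′ + y′)))
  where
  regroup : ∀ x y x′ y′ → x + y ≡ x - x′ - (y′ - y) + (x′ + y′)
  regroup = solve-∀

c∧d : ∀ {x y x′ y′} → x ≡ x′ → x - y ≡ x′ - y′ → y ≡ y′
c∧d {x} {y} {_} {y′} refl eq = neg-injective (+-cancelˡ x (- y) (- y′) eq)

c∧a : ∀ {x y x′ y′} → x ≡ x′ → x + y ≡ x′ + y′ → y ≡ y′
c∧a {x} {y} {_} {y′} refl eq = +-cancelˡ x y y′ eq

r∧d : ∀ {x y x′ y′} → y ≡ y′ → x - y ≡ x′ - y′ → x ≡ x′
r∧d {x} {y} {x′} refl eq = +-cancelʳ (- y) x x′ eq

r∧a : ∀ {x y x′ y′} → y ≡ y′ → x + y ≡ x′ + y′ → x ≡ x′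
r∧a {x} {y} {x′} refl eq = +-cancelʳ y x x′ eq

d∧a : ∀ {x y x′ y′} → x - y ≡ x′ - y′ → x + y ≡ x′ + y′ → x ≡ x′
d∧a {x} {y} {x′} {y′} eq eq′ =
  *-cancelˡ-≡ (+ 2) x x′ (trans (double x y) (trans (cong₂ _+_ eq eq′) (sym (double x′ y′))))
  where
  double : ∀ x y → + 2 * x ≡ x - y + (x + y)
  double = solve-∀

-- Negating one summand negates a sum modulo 2; `hits-odd` uses this when a new attacker switches
-- one line on.
flip₂ : ∀ p q → p xor not q ≡ not (p xor q)
flip₂ true  _ = refl
flip₂ false _ = refl

flip₃ : ∀ p q u → p xor (q xor not u) ≡ not (p xor (q xor u))
flip₃ p q u = trans (cong (p xor_) (flip₂ q u)) (flip₂ p (q xor u))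

flip₄ : ∀ p q u → p xor (q xor (u xor true)) ≡ not (p xor (q xor (u xor false)))
flip₄ p q u = trans (cong (λ b → p xor (q xor b)) (flip₂ u false)) (flip₃ p q (u xor false))

module _ {B : Board} where

  On : Line → Square B → Set
  On (c t) v = col v ≡ t
  On (r t) v = row v ≡ t
  On (d t) v = col v - row v ≡ t
  On (a t) v = col v + row v ≡ t

  on? : ∀ l v → Dec (On l v)
  on? (c t) v = col v ≟ t
  on? (r t) v = row v ≟ t
  on? (d t) v = col v - row v ≟ t
  on? (a t) v = col v + row v ≟ t

  square-≡ : {v w : Square B} → col v ≡ col w → row v ≡ row w → v ≡ w
  square-≡ p q = value-injective (cong₂ _,_ p q)

  infix 4 _≟ₛ_

  _≟ₛ_ : (v w : Square B) → Dec (v ≡ w)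
  _≟ₛ_ = ≟-refinement (×-≡-dec _≟_ _≟_)

  aligned⇒adj : ∀ l {v w} → v ≢ w → On l v → On l w → QueenAdj v w
  aligned⇒adj (c t) v≢w p q = v≢w , inj₁ (trans p (sym q))
  aligned⇒adj (r t) v≢w p q = v≢w , inj₂ (inj₁ (trans p (sym q)))
  aligned⇒adj (d t) {v} {w} v≢w p q = v≢w ,
    inj₂ (inj₂ (inj₁ (exchange⁻ (col v) (row v) (col w) (row w) (trans p (sym q)))))
  aligned⇒adj (a t) {v} {w} v≢w p q = v≢w ,
    inj₂ (inj₂ (inj₂ (exchange⁺ (col v) (row v) (col w) (row w) (trans p (sym q)))))

  data Attacked (v w : Square B) : Set where
    byC : On (c (col v)) w → Attacked v w
    byR : On (r (row v)) w → Attacked v w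
    byD : On (d (col v - row v)) w → Attacked v w
    byA : On (a (col v + row v)) w → Attacked v w

  attacked : ∀ {v w} → QueenAdj v w → Attacked v w
  attacked (_ , inj₁ eq) = byC (sym eq)
  attacked (_ , inj₂ (inj₁ eq)) = byR (sym eq)
  attacked {v} {w} (_ , inj₂ (inj₂ (inj₁ eq))) =
    byD (sym (exchange⁻ (col v) (col w) (row v) (row w) eq))
  attacked {v} {w} (_ , inj₂ (inj₂ (inj₂ eq))) =
    byA (sym (exchange⁺⁻¹ (col v) (row v) (col w) (row w) eq))

  -- From odd independent sets to models

  module _ {S : Pred (Square B) 0ℓ} (independent : Independent (Queen B) S) where

    one-per-line : ∀ l {v w} → v ∈ S → w ∈ S → On l v → On l w → v ≡ w
    one-per-line l {v} {w} v∈S w∈S p q with v ≟ₛ w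
    ... | yes v≡w = v≡w
    ... | no v≢w = contradiction (aligned⇒adj l v≢w p q) (independent v w v∈S w∈S)

    hits : Line → List (Square B) → Bool
    hits l xs = does (any? (on? l) xs)

    module _ (v : Square B) where

      -- An attacker lies on exactly one of the four lines, since two of them meet only in `v`, and
      -- by independence no two attackers share a line. Each attacker thus flips exactly one of the
      -- four values.
      hits-odd : ∀ xs → Unique xs → All (λ w → w ∈ S × QueenAdj v w) xs →
        odd (hits (c (col v)) xs) (hits (r (row v)) xs)
            (hits (d (col v - row v)) xs) (hits (a (col v + row v)) xs) ≡ parity (length xs)
      hits-odd [] _ _ = refl
      hits-odd (x ∷ xs) (x∉xs ∷ unique) ((x∈S , x~@(v≢x , _)) ∷ xs~) = trans (step (attacked x~)) (cong not (hits-odd xs unique xs~))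
        where
        misses : ∀ l → On l x → hits l xs ≡ false
        misses l x∈l = dec-false (any? (on? l) xs) (clash x∉xs xs~)
          where
          clash : ∀ {ys} → All (x ≢_) ys → All (λ w → w ∈ S × QueenAdj v w) ys → ¬ Any (On l) ys
          clash (x≢y ∷ _) ((y∈S , _) ∷ _) (here y∈l) = x≢y (one-per-line l x∈S y∈S x∈l y∈l)
          clash (_ ∷ x≢ys) (_ ∷ ys~) (there ys∈l) = clash x≢ys ys~ ys∈l

        off : ∀ l → ¬ On l x → does (on? l x) ≡ false
        off l = dec-false (on? l x)

        on : ∀ l → On l x → does (on? l x) ≡ true
        on l = dec-true (on? l x)

        apart : col x ≡ col v → row x ≡ row v → ⊥
        apart p q = v≢x (sym (square-≡ p q))

        l₁ l₂ l₃ l₄ : Line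
        l₁ = c (col v)
        l₂ = r (row v)
        l₃ = d (col v - row v)
        l₄ = a (col v + row v)

        cross : On l₃ x → On l₄ x → ⊥
        cross p q = apart eq (c∧d eq p)
          where
          eq : col x ≡ col v
          eq = d∧a {col x} {row x} {col v} {row v} p q

        step : Attacked v x →
          odd (does (on? l₁ x) ∨ hits l₁ xs) (does (on? l₂ x) ∨ hits l₂ xs)
              (does (on? l₃ x) ∨ hits l₃ xs) (does (on? l₄ x) ∨ hits l₄ xs)
          ≡ not (odd (hits l₁ xs) (hits l₂ xs) (hits l₃ xs) (hits l₄ xs))
        step (byC p)
          rewrite on l₁ p | misses l₁ p
                | off l₂ (apart p)
                | off l₃ (apart p ∘ c∧d p)
                | off l₄ (apart p ∘ c∧a p)
          = refl
        step (byR p)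
          rewrite on l₂ p | misses l₂ p
                | off l₁ (λ q → apart q p)
                | off l₃ (λ q → apart (r∧d p q) p)
                | off l₄ (λ q → apart (r∧a p q) p)
          = flip₂ (hits l₁ xs) _
        step (byD p)
          rewrite on l₃ p | misses l₃ p
                | off l₁ (λ q → apart q (c∧d q p))
                | off l₂ (λ q → apart (r∧d q p) q)
                | off l₄ (cross p)
          = flip₃ (hits l₁ xs) (hits l₂ xs) _
        step (byA p)
          rewrite on l₄ p | misses l₄ p
                | off l₁ (λ q → apart q (c∧a q p))
                | off l₂ (λ q → apart (r∧a q p) q)
                | off l₃ (λ q → cross q p)
          = flip₄ (hits l₁ xs) (hits l₂ xs) (hits l₃ xs)

    module Occupancy (odd-or-empty : ∀ v → v ∉ S → Empty (N (Queen B) v ∩ S) ⊎ HasOddSize (N (Queen B) v ∩ S)) where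

      -- Membership in `S` is not assumed decidable; this finite list replaces a search of the
      -- board.
      attackers : ∀ v → v ∉ S → ∃[ xs ] Unique xs ×
        (∀ w → w ∈ (N (Queen B) v ∩ S) ⇔ w ∈ₗ xs) × (xs ≡ [] ⊎ parity (length xs) ≡ true)
      attackers v v∉S with odd-or-empty v v∉S
      ... | inj₁ empty = [] , [] , (λ w → mk⇔ (λ w∈ → contradiction w∈ (empty w)) λ ()) , inj₁ refl
      ... | inj₂ (_ , (xs , unique , refl , iff) , odd-length) =
        xs , unique , iff , inj₂ (parity-odd (length xs) odd-length)

      Occupied : Line → Set
      Occupied l = ∃[ v ] v ∈ S × On l v

      module Avoided (v : Square B) (v∉S : v ∉ S) where

        xs : List (Square B)
        xs = proj₁ (attackers v v∉S)

        ⇔xs : ∀ w → w ∈ (N (Queen B) v ∩ S) ⇔ w ∈ₗ xs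
        ⇔xs = proj₁ (proj₂ (proj₂ (attackers v v∉S)))

        listed : ∀ {w} l → On l v → w ∈ S → On l w → w ∈ₗ xs
        listed {w} l v∈l w∈S w∈l =
          Equivalence.to (⇔xs w) (aligned⇒adj l (λ { refl → v∉S w∈S }) v∈l w∈l , w∈S)

        -- As `v` is on the line but not in `S`, every member of `S` on the line attacks `v` and is
        -- therefore listed.
        occupied⇔hit : ∀ l → On l v → Occupied l ⇔ Any (On l) xs
        occupied⇔hit l v∈l = mk⇔
          (λ (w , w∈S , w∈l) → lose (listed l v∈l w∈S w∈l) w∈l)
          (λ hit → let (w , w∈xs , w∈l) = find hit in w , proj₂ (Equivalence.from (⇔xs w) w∈xs) , w∈l)

        occupiedBy? : ∀ l → On l v → Dec (Occupied l)
        occupiedBy? l v∈l = map′ (Equivalence.from (occupied⇔hit l v∈l)) (Equivalence.to (occupied⇔hit l v∈l))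
          (any? (on? l) xs)

        hits-parity : odd (hits (c (col v)) xs) (hits (r (row v)) xs)
          (hits (d (col v - row v)) xs) (hits (a (col v + row v)) xs) ≡ parity (length xs)
        hits-parity = hits-odd v xs (proj₁ (proj₂ (attackers v v∉S)))
          (All.tabulate λ {w} w∈xs → let (v~w , w∈S) = Equivalence.from (⇔xs w) w∈xs in w∈S , v~w)

      module Lines {p} (p∈S : p ∈ S)
        {X Y : ℤ → Set} (X? : ∀ x → Dec (X x)) (Y? : ∀ y → Dec (Y y))
        (into : ∀ x y → X x → Y y → B (x , y)) (outof : ∀ x y → B (x , y) → X x × Y y)
        (onDiagonal : ∀ t → ∃₂ λ x y → X x × Y y × x - y ≡ t)
        (onAntidiagonal? : ∀ t → Dec (∃₂ λ x y → X x × Y y × x + y ≡ t)) where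

        square : ∀ {x y} → X x → Y y → Square B
        square {x} {y} x∈ y∈ = (x , y) , [ into x y x∈ y∈ ]

        -- Board membership is irrelevant in a square, so the condition is recomputed from its
        -- decision.
        col∈ : ∀ v → X (col v)
        col∈ ((x , y) , [ z∈ ]) = recompute (X? x) (proj₁ (outof x y z∈))

        row∈ : ∀ v → Y (row v)
        row∈ ((x , y) , [ z∈ ]) = recompute (Y? y) (proj₂ (outof x y z∈))

        -- The square in the column of v and the row of p is attacked by p, so its
        -- attackers are listed, and they include any queen in the column of v.
        member? : ∀ v → Dec (v ∈ S)
        member? v with v ≟ₛ p
        ... | yes refl = yes p∈S
        ... | no v≢p with col v ≟ col p
        ...   | yes eq = no λ v∈S → v≢p (one-per-line (c _) v∈S p∈S eq refl)
        ...   | no neq with Avoided.occupiedBy? w w∉S (c (col v)) refl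
          where
          w : Square B
          w = square (col∈ v) (row∈ p)
          w∉S : w ∉ S
          w∉S w∈S = neq (cong col (one-per-line (r (row p)) w∈S p∈S refl refl))
        ...     | no empty = no λ v∈S → empty (v , v∈S , refl)
        ...     | yes (u , u∈S , u∈col) with u ≟ₛ v
        ...       | yes refl = yes u∈S
        ...       | no u≢v = no λ v∈S → u≢v (one-per-line (c (col v)) u∈S v∈S u∈col refl)

        -- Supplies the square at which `occupied?` examines a line. Diagonals always meet the
        -- board, while the other lines can miss the quadrant.
        square? : ∀ l → Dec (∃[ v ] On l v)
        square? (c x) = map′ (λ x∈ → square x∈ (row∈ p) , refl) (λ (v , v∈l) → subst X v∈l (col∈ v)) (X? x)
        square? (r y) = map′ (λ y∈ → square (col∈ p) y∈ , refl) (λ (v , v∈l) → subst Y v∈l (row∈ v)) (Y? y)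
        square? (d t) = let (x , y , x∈ , y∈ , eq) = onDiagonal t in yes (square x∈ y∈ , eq)
        square? (a t) = map′ (λ (x , y , x∈ , y∈ , eq) → square x∈ y∈ , eq)
          (λ (v , eq) → col v , row v , col∈ v , row∈ v , eq) (onAntidiagonal? t)

        occupied? : ∀ l → Dec (Occupied l)
        occupied? l with square? l
        ... | no none = no λ (v , _ , v∈l) → none (v , v∈l)
        ... | yes (v , v∈l) with member? v
        ...   | yes v∈S = yes (v , v∈S , v∈l)
        ...   | no v∉S = Avoided.occupiedBy? v v∉S l v∈l

        lit : Line → Bool
        lit l = does (occupied? l)

        QueenAt : ℤ → ℤ → Set
        QueenAt x y = ∃[ v ] v ∈ S × col v ≡ x × row v ≡ y

        module _ {x y} (x∈ : X x) (y∈ : Y y) (v∉S : square x∈ y∈ ∉ S) where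

          open Avoided (square x∈ y∈) v∉S

          lit-hits : ∀ l → On l (square x∈ y∈) → lit l ≡ hits l xs
          lit-hits l v∈l = does-⇔ (occupied⇔hit l v∈l) (occupied? l) (any? (on? l) xs)

          lit-parity : odd (lit (c x)) (lit (r y)) (lit (d (x - y))) (lit (a (x + y))) ≡ parity (length xs)
          lit-parity = trans (cong₂ (λ p q → p xor q)
              (lit-hits (c x) refl) (cong₂ (λ p q → p xor q)
              (lit-hits (r y) refl) (cong₂ (λ p q → p xor q)
              (lit-hits (d (x - y)) refl) (lit-hits (a (x + y)) refl)))) hits-parity

          odd-or-none : xs ≡ [] ⊎ parity (length xs) ≡ true
          odd-or-none = proj₂ (proj₂ (proj₂ (attackers (square x∈ y∈) v∉S)))

          none-lit : xs ≡ [] → ∀ l → On l (square x∈ y∈) → lit l ≡ false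
          none-lit eq l v∈l = trans (lit-hits l v∈l) (cong (hits l) eq)

        allowed-odd : ∀ p q u v → odd p q u v ≡ true → allowed p q u v ≡ true
        allowed-odd _ _ _ _ eq rewrite eq = refl

        allowed-same : ∀ b {p q u v} → p ≡ b → q ≡ b → u ≡ b → v ≡ b → allowed p q u v ≡ true
        allowed-same true  refl refl refl refl = refl
        allowed-same false refl refl refl refl = refl

        model : Model
        model = record
          { X = X ; Y = Y ; HasQueen = QueenAt ; on = lit
          ; weak = weak ; strong = strong
          ; onc = λ { (v , v∈S , refl , refl) → dec-true (occupied? (c _)) (v , v∈S , refl) }
          ; onr = λ { (v , v∈S , refl , refl) → dec-true (occupied? (r _)) (v , v∈S , refl) }
          ; ond = λ { (v , v∈S , refl , refl) → dec-true (occupied? (d _)) (v , v∈S , refl) }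
          ; ona = λ { (v , v∈S , refl , refl) → dec-true (occupied? (a _)) (v , v∈S , refl) }
          ; inX = λ (v , _ , eq , _) → subst X eq (col∈ v)
          ; inY = λ (v , _ , _ , eq) → subst Y eq (row∈ v)
          }
          where
          weak : ∀ x y → X x → Y y → obeys allowed lit x y
          weak x y x∈ y∈ with member? (square x∈ y∈)
          ... | yes v∈S = allowed-same true (on (c x) refl) (on (r y) refl) (on (d (x - y)) refl) (on (a (x + y)) refl)
            where
            on : ∀ l → On l (square x∈ y∈) → lit l ≡ true
            on l v∈l = dec-true (occupied? l) (_ , v∈S , v∈l)
          ... | no v∉S with odd-or-none x∈ y∈ v∉S
          ...   | inj₂ eq = allowed-odd (lit (c x)) (lit (r y)) (lit (d (x - y))) (lit (a (x + y))) (trans (lit-parity x∈ y∈ v∉S) eq)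
          ...   | inj₁ eq = allowed-same false (off (c x) refl) (off (r y) refl)
            (off (d (x - y)) refl) (off (a (x + y)) refl)
            where
            off : ∀ l → On l (square x∈ y∈) → lit l ≡ false
            off = none-lit x∈ y∈ v∉S eq

          strong : ∀ {x′ y′} → QueenAt x′ y′ → ∀ x y → X x → Y y →
            (x , y) ≢ (x′ , y′) → Share x y x′ y′ → obeys odd lit x y
          strong {x′} {y′} (w , w∈S , refl , refl) x y x∈ y∈ z≢w sh = trans (lit-parity x∈ y∈ v∉S) parity≡true
            where
            v : Square B
            v = square x∈ y∈

            line : Share x y x′ y′ → ∃[ l ] On l v × On l w
            line (inj₁ eq) = c x , refl , sym eq
            line (inj₂ (inj₁ eq)) = r y , refl , sym eq
            line (inj₂ (inj₂ (inj₁ eq))) = d (x - y) , refl , sym eq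
            line (inj₂ (inj₂ (inj₂ eq))) = a (x + y) , refl , sym eq

            l : Line
            l = proj₁ (line sh)

            v∈l : On l v
            v∈l = proj₁ (proj₂ (line sh))

            w∈l : On l w
            w∈l = proj₂ (proj₂ (line sh))

            v∉S : v ∉ S
            v∉S v∈S = z≢w (cong value (one-per-line l v∈S w∈S v∈l w∈l))

            -- The queen `w` is itself an attacker, which rules out the empty list.
            parity≡true : parity (length (Avoided.xs v v∉S)) ≡ true
            parity≡true with odd-or-none x∈ y∈ v∉S
            ... | inj₂ eq = eq
            ... | inj₁ eq = contradiction (subst (w ∈ₗ_) eq (Avoided.listed v v∉S l v∈l w∈S w∈l)) λ ()

        finds-antidiagonals : FindsAntidiagonals model
        finds-antidiagonals {t} eq with witness (occupied? (a t)) eq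
        ... | v , v∈S , v∈l = col v , row v , (v , v∈S , refl , refl) , v∈l

        finds-diagonals : FindsDiagonals model
        finds-diagonals {t} eq with witness (occupied? (d t)) eq
        ... | v , v∈S , v∈l = col v , row v , (v , v∈S , refl , refl) , v∈l

-- Singletons and the two boards

module _ {B : Board} (o : Square B) where

  adj? : (v w : Square B) → Dec (QueenAdj v w)
  adj? v w = ¬? (v ≟ₛ w) ×-dec (col v ≟ col w ⊎-dec row v ≟ row w ⊎-dec
    col v - col w ≟ row v - row w ⊎-dec col v - col w ≟ row w - row v)

  singleton-odd : OddIndependent (Queen B) ｛ o ｝
  singleton-odd = (λ { v w refl refl (v≢v , _) → v≢v refl }) , λ v _ → attackers-of v
    where
    attackers-of : ∀ v → _
    attackers-of v with adj? v o
    ... | no v≁o = inj₁ λ { w (v~w , refl) → v≁o v~w }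
    ... | yes v~o = inj₂ (1 , (o ∷ [] , [] ∷ [] , refl , λ w → mk⇔
      (λ { (_ , refl) → here refl }) (λ { (here refl) → v~o , refl })) , refl)

  singleton-size : HasSize ｛ o ｝ 1
  singleton-size = o ∷ [] , [] ∷ [] , refl , λ w → mk⇔ (λ { refl → here refl }) (λ { (here refl) → refl })

one : ∀ {B} → Square B →
  (∀ S → OddIndependent (Queen B) S → ∀ {v w} → v ∈ S → w ∈ S → v ≡ w) →
  OddIndependenceNumber (Queen B) 1
one o unique = (｛ o ｝ , singleton-odd o , singleton-size o) , at-most
  where
  at-most : ∀ S → OddIndependent (Queen _) S → HasSizeAtMost S 1
  at-most S odd-S [] _ _ = ℕ.z≤n
  at-most S odd-S (_ ∷ []) _ _ = ℕ.s≤s ℕ.z≤n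
  at-most S odd-S (v ∷ w ∷ _) ((v≢w ∷ _) ∷ _) (v∈S ∷ w∈S ∷ _) = contradiction (unique S odd-S v∈S w∈S) v≢w

plane-unique : ∀ S → OddIndependent (Queen ℤ×ℤ) S → ∀ {v w} → v ∈ S → w ∈ S → v ≡ w
plane-unique S (independent , odd-or-empty) {v} {w} v∈S w∈S =
  let (p , q) = Plane.at-most-one L.model _ _ L.finds-antidiagonals L.finds-diagonals
                  (v , v∈S , refl , refl) (w , w∈S , refl , refl)
  in square-≡ p q
  where
  module L = Occupancy.Lines independent odd-or-empty v∈S {X = λ _ → ⊤} {Y = λ _ → ⊤}
    (λ _ → yes tt) (λ _ → yes tt) _ _
    (λ t → t , 0ℤ , tt , tt , i-0 t) (λ t → yes (t , 0ℤ , tt , tt , +-identityʳ t))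

quadrant-unique : ∀ S → OddIndependent (Queen ℕ×ℕ) S → ∀ {v w} → v ∈ S → w ∈ S → v ≡ w
quadrant-unique S (independent , odd-or-empty) {v} {w} v∈S w∈S =
  let (p , q) = Quadrant.at-most-one L.model ≤-trans ≤-trans L.finds-antidiagonals sum>0
                  (v , v∈S , refl , refl) (w , w∈S , refl , refl)
  in square-≡ p q
  where
  onDiagonal : ∀ t → ∃₂ λ x y → 1ℤ ≤ x × 1ℤ ≤ y × x - y ≡ t
  onDiagonal (+ n) = 1ℤ + + n , 1ℤ , +≤+ (ℕ.s≤s ℕ.z≤n) , ≤-refl , cancel (+ n)
    where
    cancel : ∀ i → 1ℤ + i - 1ℤ ≡ i
    cancel = solve-∀
  -- The row is n + 2 because `-[1+ n ]` is -(n + 1) and the column is 1.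
  onDiagonal -[1+ n ] = 1ℤ , + ℕ.suc (ℕ.suc n) , ≤-refl , +≤+ (ℕ.s≤s ℕ.z≤n) , refl

  onAntidiagonal? : ∀ t → Dec (∃₂ λ x y → 1ℤ ≤ x × 1ℤ ≤ y × x + y ≡ t)
  -- The least sum of two coordinates in the quadrant is 2.
  onAntidiagonal? t = map′
    (λ 2≤t → t - 1ℤ , 1ℤ , +-monoˡ-≤ (- 1ℤ) 2≤t , ≤-refl , cancel t)
    (λ { (x , y , 1≤x , 1≤y , refl) → +-mono-≤ 1≤x 1≤y })
    (+ 2 ≤? t)
    where
    cancel : ∀ t → t - 1ℤ + 1ℤ ≡ t
    cancel = solve-∀

  module L = Occupancy.Lines independent odd-or-empty v∈S {X = 1ℤ ≤_} {Y = 1ℤ ≤_}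
    (1ℤ ≤?_) (1ℤ ≤?_) (λ _ _ → _,_) (λ _ _ z∈ → z∈) onDiagonal onAntidiagonal?

  sum>0 : ∀ {x y} → L.QueenAt x y → 0ℤ < x + y
  sum>0 Q = <-≤-trans (+<+ (ℕ.s≤s ℕ.z≤n)) (+-mono-≤ (Model.inX L.model Q) (Model.inY L.model Q))

corollary12 : OddIndependenceNumber (Queen ℕ×ℕ) 1 × OddIndependenceNumber (Queen ℤ×ℤ) 1
corollary12 = one ((1ℤ , 1ℤ) , [ ≤-refl , ≤-refl ]) quadrant-unique , one ((0ℤ , 0ℤ) , [ tt ]) plane-unique
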